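{- Let $r\ge s\ge 1$ be integers, let $G$ be an abelian group, and let $S\neq G$ be a finite non-empty subset of $G$ such that $G$ is generated by $S-S$. Let $H$ be a hyper-atom of $S$. Then at least one of the following holds: (i) $S$ is an arithmetic progression; (ii) $|sS-rS|\ge \min\big(|G|-1,\,(r+s)|S|\big)$; (iii) $H$ is a non-zero subgroup and $sS-rS+H=sS-rS$.
   Context: Notation: $A+B=\{a+b: a\in A,\ b\in B\}$, $A-B=\{a-b: a\in A,\ b\in B\}$, $kS=S+\cdots+S$ ($k$ summands), and $sS-rS=\{x-y: x\in sS,\ y\in rS\}$. An arithmetic progression is a set of the form $\{a,a+d,\dots,a+(m-1)d\}$ with $m\ge 1$. If $G$ is infinite then $|G|-1=\infty$. Let $S$ be a finite non-empty proper subset of $G$ such that $S-S$ generates $G$ (equivalently, $S$ generates $G$ when $0\in S$). Put $$\kappa_1(S)=\min\{|X+S|-|X| : X\subset G \text{ finite non-empty},\ X+S\neq G\}.$$ A ($1$-)fragment of $S$ is a finite non-empty set $X\subset G$ with $X+S\ne G$ and $|X+S|-|X|=\kappa_1(S)$. (It is known that some subgroup of $G$, possibly $\{0\}$, is a $1$-fragment of $S$.) A hyper-atom of $S$ is a maximal element (for inclusion) among the subgroups of $G$ that are $1$-fragments of $S$. -}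

module Defs where

open import Algebra.Bundles using (AbelianGroup)
open import Axiom.ExcludedMiddle using (ExcludedMiddle)
open import Data.List.Base
  using (List; []; _∷_; length; deduplicate; cartesianProductWith; applyUpTo)
open import Data.Nat.Base as ℕ using (ℕ; zero; suc; pred)
open import Data.Product using (Σ-syntax; ∃-syntax; _×_; _,_)
open import Level using (Level; _⊔_; Lift; lift; lower)
open import Relation.Binary.Definitions using (Decidable)
open import Relation.Binary.PropositionalEquality.Core using (_≡_)
open import Relation.Nullary using (¬_; yes; no)
open import Relation.Nullary.Construct.Add.Supremum using (_⁺; ⊤⁺; [_])
open import Relation.Nullary.Decidable using (map′)
open import Relation.Unary using (Pred)

IsMinimum : ∀ {p} → Pred ℕ p → Pred ℕ p
IsMinimum P k = P k × (∀ m → P m → k ℕ.≤ m)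

-- ℕ ⁺ is the set of cardinals with a single infinite value ⊤⁺ = ∞.

pred⁺ : ℕ ⁺ → ℕ ⁺
pred⁺ [ n ] = [ pred n ]
pred⁺ ⊤⁺    = ⊤⁺

-- The minimum of an extended natural and a natural is always finite.
min : ℕ ⁺ → ℕ → ℕ
min [ m ] n = m ℕ.⊓ n
min ⊤⁺    n = n

-- Excluded middle supplies the classical metatheory: it makes equality
-- in G decidable, so that finite sets can be counted, and it decides
-- whether G is finite.
module Additive {c ℓ : Level} (em : ExcludedMiddle (c ⊔ ℓ))
                (G : AbelianGroup c ℓ) where

  open AbelianGroup G public
    using (Carrier; _≈_; setoid)
    renaming (_∙_ to _+_; ε to 0#; _⁻¹ to -_)
  open import Data.List.Membership.Setoid setoid public using (_∈_)
  open import Data.List.Relation.Binary.Subset.Setoid setoid public using (_⊆_)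
  open import Algebra.Definitions.RawMonoid (AbelianGroup.rawMonoid G) public
    using () renaming (_×_ to _×ᴳ_)

  _≟_ : Decidable _≈_
  x ≟ y = map′ lower lift (em {Lift (c ⊔ ℓ) (x ≈ y)})

  -- A finite subset of G is a list of its elements; order and repetition
  -- are disregarded, two lists being the same set when they satisfy _≋_.
  FinSet : Set c
  FinSet = List Carrier

  infix 4 _≋_
  _≋_ : FinSet → FinSet → Set (c ⊔ ℓ)
  X ≋ Y = X ⊆ Y × Y ⊆ X

  NonEmpty : FinSet → Set (c ⊔ ℓ)
  NonEmpty X = ∃[ x ] x ∈ X

  IsWhole : FinSet → Set (c ⊔ ℓ)
  IsWhole X = ∀ g → g ∈ X

  ∣_∣ : FinSet → ℕ
  ∣ X ∣ = length (deduplicate _≟_ X)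

  ∣G∣ : ℕ ⁺
  ∣G∣ with em {∃[ X ] IsWhole X}
  ... | yes (X , _) = [ ∣ X ∣ ]
  ... | no  _       = ⊤⁺

  infixl 6 _⊕_ _⊖_
  infixl 7 _·_

  _⊕_ : FinSet → FinSet → FinSet
  _⊕_ = cartesianProductWith _+_

  _⊖_ : FinSet → FinSet → FinSet
  _⊖_ = cartesianProductWith (λ x y → x + (- y))

  -- The k-fold sumset S + ⋯ + S, not the dilate {k s : s ∈ S}.
  _·_ : ℕ → FinSet → FinSet
  zero  · S = 0# ∷ []
  suc k · S = S ⊕ k · S

  data ⟨_⟩ (X : FinSet) : Pred Carrier (c ⊔ ℓ) where
    gen  : ∀ {x} → x ∈ X → ⟨ X ⟩ x
    zer  : ⟨ X ⟩ 0#
    add  : ∀ {x y} → ⟨ X ⟩ x → ⟨ X ⟩ y → ⟨ X ⟩ (x + y)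
    neg  : ∀ {x} → ⟨ X ⟩ x → ⟨ X ⟩ (- x)
    resp : ∀ {x y} → x ≈ y → ⟨ X ⟩ x → ⟨ X ⟩ y

  Generates : FinSet → Set (c ⊔ ℓ)
  Generates X = ∀ g → ⟨ X ⟩ g

  progression : Carrier → Carrier → ℕ → FinSet
  progression a d m = applyUpTo (λ i → a + i ×ᴳ d) m

  IsArithmeticProgression : FinSet → Set (c ⊔ ℓ)
  IsArithmeticProgression S =
    ∃[ a ] ∃[ d ] Σ[ m ∈ ℕ ] (1 ℕ.≤ m × S ≋ progression a d m)

  record IsSubgroup (H : FinSet) : Set (c ⊔ ℓ) where
    field
      0∈ : 0# ∈ H
      +∈ : ∀ {x y} → x ∈ H → y ∈ H → x + y ∈ H
      -∈ : ∀ {x} → x ∈ H → - x ∈ H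

  Admissible : FinSet → FinSet → Set (c ⊔ ℓ)
  Admissible S X = NonEmpty X × ¬ IsWhole (X ⊕ S)

  -- The truncation is harmless: ∣ X ∣ ≤ ∣ X ⊕ S ∣ for non-empty S.
  excess : FinSet → FinSet → ℕ
  excess S X = ∣ X ⊕ S ∣ ℕ.∸ ∣ X ∣

  IsKappa₁ : FinSet → ℕ → Set (c ⊔ ℓ)
  IsKappa₁ S = IsMinimum (λ n → ∃[ X ] (Admissible S X × excess S X ≡ n))

  IsFragment : FinSet → FinSet → Set (c ⊔ ℓ)
  IsFragment S X = Admissible S X × IsKappa₁ S (excess S X)

  -- All fragments are finite, so only finite subgroups are concerned.
  record IsHyperAtom (S H : FinSet) : Set (c ⊔ ℓ) where
    field
      subgroup : IsSubgroup H
      fragment : IsFragment S H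
      maximal  : ∀ K → IsSubgroup K → IsFragment S K → H ⊆ K → K ⊆ H

{-# OPTIONS --safe #-}
module Submission where

-- A hyper-atom H of S satisfies |H + S| < |H| + |S|. If H ≠ 0, two slices of S
-- by distinct cosets of H together have more than |H| elements, so S - S, and
-- hence sS - rS, is a union of H-cosets by the pigeonhole principle.
--
-- If H = 0, then |X + S| ≥ |X| + |S| - 1 whenever X + S ≠ G, and equality is
-- excluded for non-zero subgroups X. Unless S is a progression, |X + S| ≥ |X| + |S|
-- as soon as |X| ≥ |S| and X + S misses at least two points, and adding the
-- summands ± S one at a time gives (ii). Indeed, let X be a counterexample and
-- consider a smallest set A with |A| ≥ 2, |A + S| < |A| + |S| and A + S missing at
-- least two points. By submodularity A is contained in every such set that it
-- meets in two points; as A is not a coset of a subgroup, distinct translates of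
-- A meet in at most one point. The union of two translates of A then shows that
-- |A| = 2, which means that S is a progression of some difference d up to a set
-- of full cosets of ⟨d⟩, and this set is empty.

open import Algebra.Bundles using (AbelianGroup)
import Algebra.Properties.Group
import Algebra.Solver.CommutativeMonoid.Normal as CMNormal
open import Axiom.ExcludedMiddle using (ExcludedMiddle)
open import Data.Empty using (⊥)
open import Data.Fin.Base using (Fin; zero; suc)
open import Data.List.Base using (List; []; _∷_; _++_; map; filter; length; deduplicate)
import Data.List.Membership.Setoid.Properties as Mem
open import Data.List.Properties using (length-++; length-map)
open import Data.List.Relation.Unary.Any using (here; there)
import Data.List.Relation.Unary.Unique.DecSetoid.Properties as UniqDec
import Data.List.Relation.Unary.Unique.Setoid as UniqueSetoid
import Data.List.Relation.Unary.Unique.Setoid.Properties as Uniq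
open import Data.Nat.Base as ℕ
  using (ℕ; zero; suc; pred; _≤_; _<_; _≥_; _*_; z≤n; s≤s) renaming (_+_ to _+ℕ_)
open import Data.Nat.Induction using (<-rec)
import Data.Nat.Properties as ℕ
open import Data.Nat.Tactic.RingSolver using (solve)
open import Data.Product using (∃-syntax; ∃₂; _×_; _,_; proj₁; proj₂)
open import Data.Sum using (_⊎_; inj₁; inj₂)
open import Data.Vec.Base using (Vec; lookup)
open import Function.Base using (_∘_; id)
open import Level using (_⊔_)
open import Relation.Binary.Bundles using (DecSetoid)
open import Relation.Binary.Definitions using (_Respects_)
open import Relation.Binary.PropositionalEquality.Core as ≡ using (_≡_)
import Relation.Binary.Reasoning.Setoid as SetoidReasoning
open import Relation.Nullary using (¬_; Dec; yes; no; contradiction; ¬?)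
open import Relation.Nullary.Decidable using (True; toWitness; decidable-stable)
open import Relation.Unary using (Pred)
open import Defs

-- Linear inequalities between cardinalities.

-- Each inequality below is proved by adding its hypotheses into one `l ≤ r`; `k` collects what both
-- sides share, and the ring solver checks the two decompositions.
≤-cancel : ∀ k {l r m n} → l ≤ r → l ≡ k ℕ.+ m → r ≡ k ℕ.+ n → m ≤ n
≤-cancel k {m = m} {n} l≤r ≡.refl ≡.refl = ℕ.+-cancelˡ-≤ k m n l≤r

-- The letters a, f, i, u stand for |A|, |F|, |A ∩ F|, |A ∪ F|, and as, fs, is, us for
-- the cardinalities of the sums of these sets with S.
absorb-arith : ∀ a f i u as fs is us s → 1 ℕ.+ as ≤ a ℕ.+ s → 1 ℕ.+ fs ≤ f ℕ.+ s →
  i ℕ.+ s ≤ is → us ℕ.+ is ≤ as ℕ.+ fs → u ℕ.+ i ≡ a ℕ.+ f → 2 ℕ.+ us ≤ u ℕ.+ s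
absorb-arith a f i u as fs is us s h₁ h₂ h₃ h₄ h₅ =
  ≤-cancel (as ℕ.+ fs ℕ.+ i ℕ.+ s ℕ.+ is ℕ.+ a ℕ.+ f)
    (ℕ.+-mono-≤ h₁ (ℕ.+-mono-≤ h₂ (ℕ.+-mono-≤ h₃ (ℕ.+-mono-≤ h₄ (ℕ.≤-reflexive (≡.sym h₅))))))
    (solve (a ∷ f ∷ i ∷ u ∷ as ∷ fs ∷ is ∷ us ∷ s ∷ []))
    (solve (a ∷ f ∷ i ∷ u ∷ as ∷ fs ∷ is ∷ us ∷ s ∷ []))

-- Here `w` stands for |G| and `y` for the size of the dual of F.
frag-absorb-arith : ∀ a f i u fs s w y → a ≤ y → y ℕ.+ fs ≡ w → 2 ℕ.+ w ≤ u ℕ.+ s →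
  f ℕ.+ s ≤ 1 ℕ.+ fs → u ℕ.+ i ≡ a ℕ.+ f → ¬ 2 ≤ i
frag-absorb-arith a f i u fs s w y h₁ h₂ h₃ h₄ h₅ h₆
  with ≤-cancel (a ℕ.+ y ℕ.+ fs ℕ.+ w ℕ.+ f ℕ.+ s ℕ.+ u ℕ.+ i) {m = 4} {1}
    (ℕ.+-mono-≤ h₁ (ℕ.+-mono-≤ (ℕ.≤-reflexive h₂) (ℕ.+-mono-≤ h₃ (ℕ.+-mono-≤ h₄
      (ℕ.+-mono-≤ (ℕ.≤-reflexive h₅) h₆)))))
    (solve (a ∷ f ∷ i ∷ u ∷ fs ∷ s ∷ w ∷ y ∷ []))
    (solve (a ∷ f ∷ i ∷ u ∷ fs ∷ s ∷ w ∷ y ∷ []))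
... | s≤s ()

dual-arith : ∀ y fs w f ys s → y ℕ.+ fs ≡ w → ys ℕ.+ f ≤ w → 1 ℕ.+ fs ≤ f ℕ.+ s → 1 ℕ.+ ys ≤ y ℕ.+ s
dual-arith y fs w f ys s h₁ h₂ h₃ = ≤-cancel (w ℕ.+ f ℕ.+ fs)
  (ℕ.+-mono-≤ (ℕ.≤-reflexive (≡.sym h₁)) (ℕ.+-mono-≤ h₂ h₃))
  (solve (y ∷ fs ∷ w ∷ f ∷ ys ∷ s ∷ []))
  (solve (y ∷ fs ∷ w ∷ f ∷ ys ∷ s ∷ []))

-- F is the union of two translates of A, and `i` and `is` belong to their intersection. The sum of
-- the intersection with S has at least |S| elements, and submodularity turns this into a saving for
-- F + S.
union-arith : ∀ a f i as fs is s → fs ℕ.+ is ≤ as ℕ.+ as → 1 ℕ.+ as ≤ a ℕ.+ s → s ≤ is →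
  f ℕ.+ i ≡ a ℕ.+ a → i ≤ 1 → 1 ℕ.+ fs ≤ f ℕ.+ s
union-arith a f i as fs is s h₁ h₂ h₃ h₄ h₅ =
  ≤-cancel (is ℕ.+ as ℕ.+ as ℕ.+ a ℕ.+ a ℕ.+ i ℕ.+ s ℕ.+ 1)
    (ℕ.+-mono-≤ h₁ (ℕ.+-mono-≤ h₂ (ℕ.+-mono-≤ h₂ (ℕ.+-mono-≤ h₃ (ℕ.+-mono-≤ (ℕ.≤-reflexive (≡.sym h₄)) h₅)))))
    (solve (a ∷ f ∷ i ∷ as ∷ fs ∷ is ∷ s ∷ []))
    (solve (a ∷ f ∷ i ∷ as ∷ fs ∷ is ∷ s ∷ []))

-- F is again a union of two translates of A meeting in `i` points, `w` is |G|, and `y` is the size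
-- of the dual of the fragment T described by `t` and `ts`.
small-arith : ∀ a f i fs s w y t ts → w ≤ suc fs → 1 ℕ.+ fs ≤ f ℕ.+ s → f ℕ.+ i ≡ a ℕ.+ a → 1 ≤ i →
  a ≤ y → y ℕ.+ ts ≡ w → t ℕ.+ s ≤ 1 ℕ.+ ts → s ≤ t → s ≤ a
small-arith a f i fs s w y t ts h₁ h₂ h₃ h₄ h₅ h₆ h₇ h₈ =
  ≤-cancel (w ℕ.+ fs ℕ.+ f ℕ.+ i ℕ.+ 1 ℕ.+ a ℕ.+ y ℕ.+ ts ℕ.+ t ℕ.+ s ℕ.+ 1)
    (ℕ.+-mono-≤ h₁ (ℕ.+-mono-≤ h₂ (ℕ.+-mono-≤ (ℕ.≤-reflexive h₃) (ℕ.+-mono-≤ h₄ (ℕ.+-mono-≤ h₅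
      (ℕ.+-mono-≤ (ℕ.≤-reflexive h₆) (ℕ.+-mono-≤ h₇ h₈)))))))
    (solve (a ∷ f ∷ i ∷ fs ∷ s ∷ w ∷ y ∷ t ∷ ts ∷ []))
    (solve (a ∷ f ∷ i ∷ fs ∷ s ∷ w ∷ y ∷ t ∷ ts ∷ []))

progression-arith : ∀ s t ts w r k → 2 ℕ.+ ts ≤ w → w ≤ r ℕ.+ k → k ≤ r → t ℕ.+ s ≤ suc ts → s ≤ t →
  ¬ suc r ≤ s
progression-arith s t ts w r k h₁ h₂ h₃ h₄ h₅ h₆
  with ≤-cancel (ts ℕ.+ w ℕ.+ k ℕ.+ t ℕ.+ s ℕ.+ s ℕ.+ r ℕ.+ r) {m = 4} {1}
    (ℕ.+-mono-≤ h₁ (ℕ.+-mono-≤ h₂ (ℕ.+-mono-≤ h₃ (ℕ.+-mono-≤ h₄ (ℕ.+-mono-≤ h₅ (ℕ.+-mono-≤ h₆ h₆))))))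
    (solve (s ∷ t ∷ ts ∷ w ∷ r ∷ k ∷ []))
    (solve (s ∷ t ∷ ts ∷ w ∷ r ∷ k ∷ []))
... | s≤s ()

-- With U a union of two cosets of H, `σ` counts the points of S outside U and `ι` those inside; `a`
-- and `b` are the sizes of the two slices.
coset-arith : ∀ h u σ hs s ι a b → u ≡ h ℕ.+ h → u ℕ.+ σ ≤ hs → 1 ℕ.+ hs ≤ h ℕ.+ s →
  s ≡ ι ℕ.+ σ → ι ≤ a ℕ.+ b → 1 ℕ.+ h ≤ a ℕ.+ b
coset-arith h u σ hs s ι a b h₁ h₂ h₃ h₄ h₅ = ≤-cancel (u ℕ.+ σ ℕ.+ hs ℕ.+ s ℕ.+ ι ℕ.+ h)
  (ℕ.+-mono-≤ (ℕ.≤-reflexive (≡.sym h₁)) (ℕ.+-mono-≤ h₂ (ℕ.+-mono-≤ h₃ (ℕ.+-mono-≤ (ℕ.≤-reflexive h₄) h₅))))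
  (solve (h ∷ u ∷ σ ∷ hs ∷ s ∷ ι ∷ a ∷ b ∷ []))
  (solve (h ∷ u ∷ σ ∷ hs ∷ s ∷ ι ∷ a ∷ b ∷ []))

half-< : ∀ {h} a b → h < a ℕ.+ b → h < a ℕ.+ a ⊎ h < b ℕ.+ b
half-< a b h<a+b with ℕ.≤-total a b
... | inj₁ a≤b = inj₂ (ℕ.≤-trans h<a+b (ℕ.+-monoˡ-≤ b a≤b))
... | inj₂ b≤a = inj₁ (ℕ.≤-trans h<a+b (ℕ.+-monoʳ-≤ a b≤a))

minimum : ∀ {p} → ExcludedMiddle p → (P : ℕ → Set p) → ∀ n → P n → ∃[ k ] IsMinimum P k
minimum em P = <-rec _ λ n rec Pn → case-em n rec Pn em
  where
  case-em : ∀ n → (∀ {m} → m < n → P m → ∃[ k ] IsMinimum P k) → P n →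
            Dec (∃[ m ] (m < n × P m)) → ∃[ k ] IsMinimum P k
  case-em n rec Pn (yes (m , m<n , Pm)) = rec m<n Pm
  case-em n rec Pn (no none) = n , Pn , λ m Pm → ℕ.≮⇒≥ λ m<n → none (m , m<n , Pm)

-- A solver for identities in abelian groups.

infixl 6 _:+_
infix 8 :-_

data Expr (n : ℕ) : Set where
  var  : Fin n → Expr n
  :0   : Expr n
  _:+_ : Expr n → Expr n → Expr n
  :-_  : Expr n → Expr n

v0 : ∀ {n} → Expr (suc n)
v0 = var zero

v1 : ∀ {n} → Expr (suc (suc n))
v1 = var (suc zero)

v2 : ∀ {n} → Expr (suc (suc (suc n)))
v2 = var (suc (suc zero))

v3 : ∀ {n} → Expr (suc (suc (suc (suc n))))
v3 = var (suc (suc (suc zero)))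

v4 : ∀ {n} → Expr (suc (suc (suc (suc (suc n)))))
v4 = var (suc (suc (suc (suc zero))))

module GroupSolver {c ℓ} (G : AbelianGroup c ℓ) where
  open AbelianGroup G
  open import Algebra.Properties.Group group using (∙-cancelʳ)
  module CM = CMNormal commutativeMonoid

  eval : ∀ {n} → Expr n → Vec Carrier n → Carrier
  eval (var i)  ρ = lookup ρ i
  eval :0       ρ = ε
  eval (e :+ f) ρ = eval e ρ ∙ eval f ρ
  eval (:- e)   ρ = eval e ρ ⁻¹

  -- An expression is read as a formal difference `pos e - neg e`. Negation exchanges the two
  -- halves, so that a normaliser for commutative monoids suffices.
  pos neg : ∀ {n} → Expr n → CM.Expr n
  pos (var i)  = CM.var i
  pos :0       = CM.id
  pos (e :+ f) = pos e CM.⊕ pos f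
  pos (:- e)   = neg e
  neg (var i)  = CM.id
  neg :0       = CM.id
  neg (e :+ f) = neg e CM.⊕ neg f
  neg (:- e)   = pos e

  open SetoidReasoning setoid
  open import Algebra.Properties.CommutativeSemigroup commutativeSemigroup using (interchange)

  eval-split : ∀ {n} (e : Expr n) ρ → eval e ρ ∙ CM.⟦ neg e ⟧ ρ ≈ CM.⟦ pos e ⟧ ρ
  eval-split (var i)  ρ = identityʳ _
  eval-split :0       ρ = identityʳ _
  eval-split (e :+ f) ρ = trans (interchange _ _ _ _) (∙-cong (eval-split e ρ) (eval-split f ρ))
  eval-split (:- e)   ρ = begin
    eval e ρ ⁻¹ ∙ CM.⟦ pos e ⟧ ρ               ≈⟨ ∙-congˡ (eval-split e ρ) ⟨
    eval e ρ ⁻¹ ∙ (eval e ρ ∙ CM.⟦ neg e ⟧ ρ)  ≈⟨ assoc _ _ _ ⟨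
    eval e ρ ⁻¹ ∙ eval e ρ ∙ CM.⟦ neg e ⟧ ρ    ≈⟨ ∙-congʳ (inverseˡ _) ⟩
    ε ∙ CM.⟦ neg e ⟧ ρ                         ≈⟨ identityˡ _ ⟩
    CM.⟦ neg e ⟧ ρ                             ∎

  -- An identity e = f of abelian groups amounts to the identity
  -- pos e + neg f = pos f + neg e of commutative monoids.
  identity! : ∀ {n} (e f : Expr n) →
              {True (CM.normalise (pos e CM.⊕ neg f) CM.≟ CM.normalise (pos f CM.⊕ neg e))} →
              ∀ ρ → eval e ρ ≈ eval f ρ
  identity! e f {eq} ρ = ∙-cancelʳ (n e ∙ n f) _ _ (begin
    eval e ρ ∙ (n e ∙ n f)          ≈⟨ assoc _ _ _ ⟨
    eval e ρ ∙ n e ∙ n f            ≈⟨ ∙-congʳ (eval-split e ρ) ⟩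
    CM.⟦ pos e CM.⊕ neg f ⟧ ρ       ≈⟨ CM.correct (pos e CM.⊕ neg f) ρ ⟨
    CM.⟦ CM.normalise (pos e CM.⊕ neg f) ⟧⇓ ρ  ≡⟨ ≡.cong (λ v → CM.⟦ v ⟧⇓ ρ) (toWitness eq) ⟩
    CM.⟦ CM.normalise (pos f CM.⊕ neg e) ⟧⇓ ρ  ≈⟨ CM.correct (pos f CM.⊕ neg e) ρ ⟩
    CM.⟦ pos f CM.⊕ neg e ⟧ ρ       ≈⟨ ∙-congʳ (eval-split f ρ) ⟨
    eval f ρ ∙ n f ∙ n e            ≈⟨ assoc _ _ _ ⟩
    eval f ρ ∙ (n f ∙ n e)          ≈⟨ ∙-congˡ (comm _ _) ⟩
    eval f ρ ∙ (n e ∙ n f)          ∎)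
    where n = λ e → CM.⟦ neg e ⟧ ρ

module Sumsets {c ℓ} (em : ExcludedMiddle (c ⊔ ℓ)) (G : AbelianGroup c ℓ) where
  open Additive em G
  open GroupSolver G using (identity!)
  open import Data.List.Relation.Unary.All using ([]; _∷_)
  open import Data.List.Relation.Unary.AllPairs using ([]; _∷_)
  open import Data.Vec.Base using ([]; _∷_)
  open AbelianGroup G using ()
    renaming ( refl to ≈-refl; sym to ≈-sym; trans to ≈-trans; ∙-cong to +-cong
             ; ∙-congˡ to +-congˡ; ∙-congʳ to +-congʳ; ⁻¹-cong to -‿cong; inverseʳ to +-inverseʳ
             ; inverseˡ to +-inverseˡ; identityˡ to +-identityˡ; identityʳ to +-identityʳ
             ; assoc to +-assoc; comm to +-comm)
  open Algebra.Properties.Group (AbelianGroup.group G) using ()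
    renaming ( ∙-cancelˡ to +-cancelˡ; ∙-cancelʳ to +-cancelʳ; ⁻¹-injective to -‿injective
             ; ⁻¹-involutive to -‿involutive)
  open UniqueSetoid setoid using (Unique)
  open import Data.List.Membership.Setoid setoid using (_∉_)

  -- Finite sets and their cardinalities.

  dec : (P : Set (c ⊔ ℓ)) → Dec P
  dec P = em {P}

  by-contradiction : ∀ {P : Set (c ⊔ ℓ)} → ¬ ¬ P → P
  by-contradiction {P} = decidable-stable (dec P)

  _∈?_ : ∀ x X → Dec (x ∈ X)
  x ∈? X = dec (x ∈ X)

  ∈-resp : ∀ {X x y} → x ≈ y → x ∈ X → y ∈ X
  ∈-resp = Mem.∈-resp-≈ setoid

  infixl 6 _∩_ _∖_

  ∉-resp : ∀ {X x y} → x ≈ y → x ∉ X → y ∉ X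
  ∉-resp x≈y x∉X y∈X = x∉X (∈-resp (≈-sym x≈y) y∈X)

  opaque
    _∩_ _∖_ : FinSet → FinSet → FinSet
    X ∩ Y = filter (_∈? Y) X
    X ∖ Y = filter (¬? ∘ (_∈? Y)) X

    ∈-∩⁺ : ∀ {X Y x} → x ∈ X → x ∈ Y → x ∈ X ∩ Y
    ∈-∩⁺ {Y = Y} = Mem.∈-filter⁺ setoid (_∈? Y) ∈-resp

    ∈-∩⁻ : ∀ {X Y x} → x ∈ X ∩ Y → x ∈ X × x ∈ Y
    ∈-∩⁻ {Y = Y} = Mem.∈-filter⁻ setoid (_∈? Y) ∈-resp

    ∈-∖⁺ : ∀ {X Y x} → x ∈ X → x ∉ Y → x ∈ X ∖ Y
    ∈-∖⁺ {Y = Y} = Mem.∈-filter⁺ setoid (¬? ∘ (_∈? Y)) ∉-resp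

    ∈-∖⁻ : ∀ {X Y x} → x ∈ X ∖ Y → x ∈ X × x ∉ Y
    ∈-∖⁻ {Y = Y} = Mem.∈-filter⁻ setoid (¬? ∘ (_∈? Y)) ∉-resp

  ∈-++⁺ˡ : ∀ {X Y x} → x ∈ X → x ∈ X ++ Y
  ∈-++⁺ˡ = Mem.∈-++⁺ˡ setoid

  ∈-++⁺ʳ : ∀ X {Y x} → x ∈ Y → x ∈ X ++ Y
  ∈-++⁺ʳ X = Mem.∈-++⁺ʳ setoid X

  ∈-++⁻ : ∀ X {Y x} → x ∈ X ++ Y → x ∈ X ⊎ x ∈ Y
  ∈-++⁻ X = Mem.∈-++⁻ setoid X

  private
    decSetoid : DecSetoid c ℓ
    decSetoid = record { isDecEquivalence = record
      { isEquivalence = AbelianGroup.isEquivalence G ; _≟_ = _≟_ } }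

    ∈-dedup⁺ : ∀ {X x} → x ∈ X → x ∈ deduplicate _≟_ X
    ∈-dedup⁺ = Mem.∈-deduplicate⁺ setoid _≟_ (λ y≈z x≈y → ≈-trans x≈y (≈-sym y≈z))

    ∈-dedup⁻ : ∀ {X x} → x ∈ deduplicate _≟_ X → x ∈ X
    ∈-dedup⁻ {X} = Mem.∈-deduplicate⁻ setoid _≟_ X

    dedup-! : ∀ X → Unique (deduplicate _≟_ X)
    dedup-! = UniqDec.deduplicate-! decSetoid

    remove : ∀ {x Y} → x ∈ Y → ∃[ Z ] length Y ≡ suc (length Z) × (∀ {y} → ¬ y ≈ x → y ∈ Y → y ∈ Z)
    remove {Y = z ∷ Y} (here x≈z) = Y , ≡.refl , λ
      { y≉x (here y≈z) → contradiction (≈-trans y≈z (≈-sym x≈z)) y≉x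
      ; _ (there y∈Y) → y∈Y }
    remove {Y = z ∷ Y} (there x∈Y) with remove x∈Y
    ... | Z , eq , keep = z ∷ Z , ≡.cong suc eq , λ
      { _ (here y≈z) → here y≈z
      ; y≉x (there y∈Y) → there (keep y≉x y∈Y) }

    -- By induction on `X`: its head is removed from `Y`, and the remaining elements survive the
    -- removal because they differ from the head.
    length-⊆ : ∀ {X Y} → Unique X → X ⊆ Y → length X ≤ length Y
    length-⊆ {[]} _ _ = z≤n
    length-⊆ {x ∷ X} {Y} (x∉ ∷ X!) X⊆Y with remove (X⊆Y (here ≈-refl))
    ... | Z , eq , keep = ≡.subst (suc (length X) ≤_) (≡.sym eq)
      (s≤s (length-⊆ X! λ y∈X → keep
        (λ y≈x → Uniq.Unique[x∷xs]⇒x∉xs setoid (x∉ ∷ X!) (∈-resp y≈x y∈X))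
        (X⊆Y (there y∈X))))

    -- Any enumeration without repetition may be counted in place of the one chosen by
    -- `deduplicate`.
    card-unique : ∀ {X Y} → Unique Y → Y ≋ X → ∣ X ∣ ≡ length Y
    card-unique {X} Y! (Y⊆X , X⊆Y) = ℕ.≤-antisym
      (length-⊆ (dedup-! X) (X⊆Y ∘ ∈-dedup⁻))
      (length-⊆ Y! (∈-dedup⁺ ∘ Y⊆X))

  card-mono : ∀ X Y → X ⊆ Y → ∣ X ∣ ≤ ∣ Y ∣
  card-mono X Y X⊆Y = length-⊆ (dedup-! X) (∈-dedup⁺ ∘ X⊆Y ∘ ∈-dedup⁻)

  card-cong : ∀ X Y → X ≋ Y → ∣ X ∣ ≡ ∣ Y ∣
  card-cong X Y (X⊆Y , Y⊆X) = ℕ.≤-antisym (card-mono X Y X⊆Y) (card-mono Y X Y⊆X)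

  card-⊎ : ∀ {X Y} → (∀ {x} → x ∈ X → x ∉ Y) → ∣ X ++ Y ∣ ≡ ∣ X ∣ ℕ.+ ∣ Y ∣
  card-⊎ {X} {Y} disjoint = ≡.trans
    (card-unique
      (Uniq.++⁺ setoid (dedup-! X) (dedup-! Y) λ (p , q) → disjoint (∈-dedup⁻ p) (∈-dedup⁻ q))
      (to , from))
    (length-++ (deduplicate _≟_ X))
    where
    to : deduplicate _≟_ X ++ deduplicate _≟_ Y ⊆ X ++ Y
    to p with ∈-++⁻ (deduplicate _≟_ X) p
    ... | inj₁ q = ∈-++⁺ˡ (∈-dedup⁻ q)
    ... | inj₂ q = ∈-++⁺ʳ X (∈-dedup⁻ q)
    from : X ++ Y ⊆ deduplicate _≟_ X ++ deduplicate _≟_ Y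
    from p with ∈-++⁻ X p
    ... | inj₁ q = ∈-++⁺ˡ (∈-dedup⁺ q)
    ... | inj₂ q = ∈-++⁺ʳ (deduplicate _≟_ X) (∈-dedup⁺ q)

  card-map : ∀ {f} → (∀ {x y} → x ≈ y → f x ≈ f y) → (∀ {x y} → f x ≈ f y → x ≈ y) →
             ∀ X → ∣ map f X ∣ ≡ ∣ X ∣
  card-map {f} f-cong f-inj X = ≡.trans
    (card-unique (Uniq.map⁺ setoid setoid f-inj (dedup-! X)) (to , from))
    (length-map f (deduplicate _≟_ X))
    where
    to : map f (deduplicate _≟_ X) ⊆ map f X
    to p with Mem.∈-map⁻ setoid setoid p
    ... | x , x∈ , y≈ = ∈-resp (≈-sym y≈) (Mem.∈-map⁺ setoid setoid f-cong (∈-dedup⁻ x∈))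
    from : map f X ⊆ map f (deduplicate _≟_ X)
    from p with Mem.∈-map⁻ setoid setoid p
    ... | x , x∈ , y≈ = ∈-resp (≈-sym y≈) (Mem.∈-map⁺ setoid setoid f-cong (∈-dedup⁺ x∈))

  card-split : ∀ X Y → ∣ X ∣ ≡ ∣ X ∩ Y ∣ ℕ.+ ∣ X ∖ Y ∣
  card-split X Y = ≡.trans (card-cong _ _ (to , from))
    (card-⊎ λ p q → proj₂ (∈-∖⁻ {X} q) (proj₂ (∈-∩⁻ {X} p)))
    where
    to : X ⊆ (X ∩ Y) ++ (X ∖ Y)
    to {x} x∈X with x ∈? Y
    ... | yes x∈Y = ∈-++⁺ˡ (∈-∩⁺ x∈X x∈Y)
    ... | no  x∉Y = ∈-++⁺ʳ (X ∩ Y) (∈-∖⁺ x∈X x∉Y)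
    from : (X ∩ Y) ++ (X ∖ Y) ⊆ X
    from p with ∈-++⁻ (X ∩ Y) p
    ... | inj₁ q = proj₁ (∈-∩⁻ q)
    ... | inj₂ q = proj₁ (∈-∖⁻ {Y = Y} q)

  card-∪-∖ : ∀ X Y → ∣ X ++ Y ∣ ≡ ∣ X ∣ ℕ.+ ∣ Y ∖ X ∣
  card-∪-∖ X Y = ≡.trans (card-cong _ _ (to , from))
    (card-⊎ λ p q → proj₂ (∈-∖⁻ {Y} q) p)
    where
    to : X ++ Y ⊆ X ++ (Y ∖ X)
    to {x} p with x ∈? X | ∈-++⁻ X p
    ... | yes x∈X | _        = ∈-++⁺ˡ x∈X
    ... | no x∉X  | inj₁ x∈X = contradiction x∈X x∉X
    ... | no x∉X  | inj₂ x∈Y = ∈-++⁺ʳ X (∈-∖⁺ x∈Y x∉X)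
    from : X ++ (Y ∖ X) ⊆ X ++ Y
    from p with ∈-++⁻ X p
    ... | inj₁ q = ∈-++⁺ˡ q
    ... | inj₂ q = ∈-++⁺ʳ X (proj₁ (∈-∖⁻ {Y = X} q))

  card-∩-comm : ∀ X Y → ∣ X ∩ Y ∣ ≡ ∣ Y ∩ X ∣
  card-∩-comm X Y = card-cong _ _ (swap , swap)
    where
    swap : ∀ {X Y} → X ∩ Y ⊆ Y ∩ X
    swap {X} {Y} p = let x∈X , x∈Y = ∈-∩⁻ {X} {Y} p in ∈-∩⁺ x∈Y x∈X

  card-∪-∩ : ∀ X Y → ∣ X ++ Y ∣ ℕ.+ ∣ X ∩ Y ∣ ≡ ∣ X ∣ ℕ.+ ∣ Y ∣
  card-∪-∩ X Y = begin-equality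
    ∣ X ++ Y ∣ ℕ.+ ∣ X ∩ Y ∣               ≡⟨ ≡.cong₂ ℕ._+_ (card-∪-∖ X Y) (card-∩-comm X Y) ⟩
    ∣ X ∣ ℕ.+ ∣ Y ∖ X ∣ ℕ.+ ∣ Y ∩ X ∣      ≡⟨ ℕ.+-assoc ∣ X ∣ _ _ ⟩
    ∣ X ∣ ℕ.+ (∣ Y ∖ X ∣ ℕ.+ ∣ Y ∩ X ∣)    ≡⟨ ≡.cong (∣ X ∣ ℕ.+_) (ℕ.+-comm ∣ Y ∖ X ∣ _) ⟩
    ∣ X ∣ ℕ.+ (∣ Y ∩ X ∣ ℕ.+ ∣ Y ∖ X ∣)    ≡⟨ ≡.cong (∣ X ∣ ℕ.+_) (card-split Y X) ⟨
    ∣ X ∣ ℕ.+ ∣ Y ∣                        ∎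
    where open ℕ.≤-Reasoning

  card-∪-≤ : ∀ X Y → ∣ X ++ Y ∣ ≤ ∣ X ∣ ℕ.+ ∣ Y ∣
  card-∪-≤ X Y = ≡.subst (∣ X ++ Y ∣ ≤_) (card-∪-∩ X Y) (ℕ.m≤m+n _ _)

  card≡0⇒∉ : ∀ {X} → ∣ X ∣ ≡ 0 → ∀ {x} → x ∉ X
  card≡0⇒∉ {X} eq x∈X with card-mono (_ ∷ []) X (λ { (here y≈x) → ∈-resp (≈-sym y≈x) x∈X })
  ... | 1≤ rewrite eq = contradiction 1≤ λ ()

  1≤card : ∀ {X} → NonEmpty X → 1 ≤ ∣ X ∣
  1≤card {X} (x , x∈X) = ℕ.n≢0⇒n>0 λ eq → card≡0⇒∉ {X} eq x∈X

  1≤card⁻ : ∀ {X} → 1 ≤ ∣ X ∣ → NonEmpty X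
  1≤card⁻ {x ∷ X} _ = x , here ≈-refl

  ⊆∧≥⇒⊇ : ∀ {X Y} → X ⊆ Y → ∣ Y ∣ ≤ ∣ X ∣ → Y ⊆ X
  ⊆∧≥⇒⊇ {X} {Y} X⊆Y Y≤X {y} y∈Y with y ∈? X
  ... | yes y∈X = y∈X
  ... | no  y∉X = contradiction (card≡0⇒∉ {Y ∖ X} (ℕ.n≤0⇒n≡0 (ℕ.+-cancelˡ-≤ ∣ X ∣ _ 0 (begin
      ∣ X ∣ ℕ.+ ∣ Y ∖ X ∣  ≡⟨ card-∪-∖ X Y ⟨
      ∣ X ++ Y ∣           ≤⟨ card-mono (X ++ Y) Y go ⟩
      ∣ Y ∣                ≤⟨ Y≤X ⟩
      ∣ X ∣                ≡⟨ ℕ.+-identityʳ _ ⟨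
      ∣ X ∣ ℕ.+ 0          ∎))) (∈-∖⁺ y∈Y y∉X)) λ ()
    where
    open ℕ.≤-Reasoning
    go : X ++ Y ⊆ Y
    go p with ∈-++⁻ X p
    ... | inj₁ q = X⊆Y q
    ... | inj₂ q = q

  card-pair : ∀ {x y} → ¬ x ≈ y → ∣ x ∷ y ∷ [] ∣ ≡ 2
  card-pair {x} {y} x≉y = card-unique ((x≉y ∷ []) ∷ [] ∷ []) (id , id)

  2≤card : ∀ {X x y} → x ∈ X → y ∈ X → ¬ x ≈ y → 2 ≤ ∣ X ∣
  2≤card {X} {x} {y} x∈X y∈X x≉y = ≡.subst (_≤ ∣ X ∣) (card-pair x≉y) (card-mono (x ∷ y ∷ []) X λ
    { (here z≈x) → ∈-resp (≈-sym z≈x) x∈X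
    ; (there (here z≈y)) → ∈-resp (≈-sym z≈y) y∈X })

  2≤card⁻ : ∀ {X} → 2 ≤ ∣ X ∣ → ∃₂ λ x y → x ∈ X × y ∈ X × ¬ x ≈ y
  2≤card⁻ {X} 2≤ with deduplicate _≟_ X | dedup-! X | ∈-dedup⁻ {X}
  2≤card⁻ (s≤s ()) | _ ∷ [] | _ | _
  ... | x ∷ y ∷ _ | (x≉y ∷ _) ∷ _ | from =
    x , y , from (here ≈-refl) , from (there (here ≈-refl)) , x≉y

  3≤card⁻ : ∀ {X} → 3 ≤ ∣ X ∣ → ∃₂ λ x y → ∃[ z ] (x ∈ X × y ∈ X × z ∈ X × ¬ x ≈ y × ¬ x ≈ z × ¬ y ≈ z)
  3≤card⁻ {X} 3≤ with deduplicate _≟_ X | dedup-! X | ∈-dedup⁻ {X}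
  3≤card⁻ (s≤s (s≤s ())) | _ ∷ _ ∷ [] | _ | _
  ... | x ∷ y ∷ z ∷ _ | (x≉y ∷ x≉z ∷ _) ∷ (y≉z ∷ _) ∷ _ | from =
    x , y , z , from (here ≈-refl) , from (there (here ≈-refl)) ,
    from (there (there (here ≈-refl))) , x≉y , x≉z , y≉z

  opaque
    select : Pred Carrier (c ⊔ ℓ) → FinSet → FinSet
    select P = filter λ x → dec (P x)

    ∈-select⁺ : ∀ {P X x} → P Respects _≈_ → x ∈ X → P x → x ∈ select P X
    ∈-select⁺ {P} P-resp = Mem.∈-filter⁺ setoid (λ x → dec (P x)) P-resp

    ∈-select⁻ : ∀ {P X x} → P Respects _≈_ → x ∈ select P X → x ∈ X × P x
    ∈-select⁻ {P} P-resp = Mem.∈-filter⁻ setoid (λ x → dec (P x)) P-resp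

  -- Pigeonhole: disjoint `X` and `Y` would have a union larger than `Z`.
  card-overlap : ∀ {X Y Z} → X ⊆ Z → Y ⊆ Z → ∣ Z ∣ < ∣ X ∣ ℕ.+ ∣ Y ∣ → ∃[ z ] (z ∈ X × z ∈ Y)
  card-overlap {X} {Y} {Z} X⊆Z Y⊆Z Z< = by-contradiction λ none →
    ℕ.<⇒≱ Z< (≡.subst (_≤ ∣ Z ∣) (card-⊎ {X} {Y} λ x∈X x∈Y → none (_ , x∈X , x∈Y))
      (card-mono (X ++ Y) Z (λ p → join (∈-++⁻ X p))))
    where
    join : ∀ {x} → x ∈ X ⊎ x ∈ Y → x ∈ Z
    join (inj₁ x∈X) = X⊆Z x∈X
    join (inj₂ x∈Y) = Y⊆Z x∈Y

  -- Sumsets, translates and negatives.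

  ∈-⊕⁺ : ∀ {X Y x y} → x ∈ X → y ∈ Y → x + y ∈ X ⊕ Y
  ∈-⊕⁺ = Mem.∈-cartesianProductWith⁺ setoid setoid setoid +-cong

  ∈-⊕⁻ : ∀ X Y {z} → z ∈ X ⊕ Y → ∃₂ λ x y → x ∈ X × y ∈ Y × z ≈ x + y
  ∈-⊕⁻ = Mem.∈-cartesianProductWith⁻ setoid setoid setoid _+_

  ∈-⊖⁺ : ∀ {X Y x y} → x ∈ X → y ∈ Y → x + (- y) ∈ X ⊖ Y
  ∈-⊖⁺ = Mem.∈-cartesianProductWith⁺ setoid setoid setoid (λ p q → +-cong p (-‿cong q))

  ∈-⊖⁻ : ∀ X Y {z} → z ∈ X ⊖ Y → ∃₂ λ x y → x ∈ X × y ∈ Y × z ≈ x + (- y)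
  ∈-⊖⁻ = Mem.∈-cartesianProductWith⁻ setoid setoid setoid (λ x y → x + (- y))

  opaque
    shift : Carrier → FinSet → FinSet
    shift x = map (x +_)

    opp : FinSet → FinSet
    opp = map -_

    ∈-shift⁺ : ∀ {x X y} → y ∈ X → x + y ∈ shift x X
    ∈-shift⁺ = Mem.∈-map⁺ setoid setoid +-congˡ

    ∈-shift⁻ : ∀ {x X z} → z ∈ shift x X → ∃[ y ] (y ∈ X × z ≈ x + y)
    ∈-shift⁻ = Mem.∈-map⁻ setoid setoid

    card-shift : ∀ x X → ∣ shift x X ∣ ≡ ∣ X ∣
    card-shift x = card-map +-congˡ (+-cancelˡ x _ _)

    ∈-opp⁺ : ∀ {X y} → y ∈ X → - y ∈ opp X
    ∈-opp⁺ = Mem.∈-map⁺ setoid setoid -‿cong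

    ∈-opp⁻ : ∀ {X z} → z ∈ opp X → ∃[ y ] (y ∈ X × z ≈ - y)
    ∈-opp⁻ = Mem.∈-map⁻ setoid setoid

    card-opp : ∀ X → ∣ opp X ∣ ≡ ∣ X ∣
    card-opp = card-map -‿cong -‿injective

  ∈-shift⁺′ : ∀ {x X z} → z + (- x) ∈ X → z ∈ shift x X
  ∈-shift⁺′ {x} {z = z} p =
    ∈-resp (identity! (v0 :+ (v1 :+ :- v0)) v1 (x ∷ z ∷ [])) (∈-shift⁺ p)

  ∈-shift⁻′ : ∀ {x X z} → z ∈ shift x X → z + (- x) ∈ X
  ∈-shift⁻′ {x} p with ∈-shift⁻ p
  ... | y , y∈X , z≈ = ∈-resp
    (≈-sym (≈-trans (+-congʳ z≈) (identity! (v0 :+ v1 :+ :- v0) v1 (x ∷ y ∷ [])))) y∈X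

  ∈-opp⁻′ : ∀ {X z} → z ∈ opp X → - z ∈ X
  ∈-opp⁻′ p with ∈-opp⁻ p
  ... | y , y∈X , z≈ = ∈-resp (≈-sym (≈-trans (-‿cong z≈) (-‿involutive y))) y∈X

  ⊕-monoˡ : ∀ X Y S → X ⊆ Y → X ⊕ S ⊆ Y ⊕ S
  ⊕-monoˡ X Y S X⊆Y p with ∈-⊕⁻ X S p
  ... | x , s , x∈X , s∈S , z≈ = ∈-resp (≈-sym z≈) (∈-⊕⁺ (X⊆Y x∈X) s∈S)

  shift-⊕ : ∀ x X S → shift x X ⊕ S ≋ shift x (X ⊕ S)
  shift-⊕ x X S = to , from
    where
    to : shift x X ⊕ S ⊆ shift x (X ⊕ S)
    to p with ∈-⊕⁻ (shift x X) S p
    ... | y , s , y∈ , s∈S , z≈ = ∈-shift⁺′ (∈-resp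
      (≈-sym (≈-trans (+-congʳ z≈) (identity! (v0 :+ v1 :+ :- v2) (v0 :+ :- v2 :+ v1) (y ∷ s ∷ x ∷ []))))
      (∈-⊕⁺ (∈-shift⁻′ y∈) s∈S))
    from : shift x (X ⊕ S) ⊆ shift x X ⊕ S
    from p with ∈-shift⁻ p
    ... | y , y∈ , z≈ with ∈-⊕⁻ X S y∈
    ... | w , s , w∈X , s∈S , y≈ = ∈-resp
      (≈-sym (≈-trans z≈ (≈-trans (+-congˡ y≈) (≈-sym (+-assoc x w s)))))
      (∈-⊕⁺ (∈-shift⁺ w∈X) s∈S)

  card-shift-⊕ : ∀ x X S → ∣ shift x X ⊕ S ∣ ≡ ∣ X ⊕ S ∣
  card-shift-⊕ x X S =
    ≡.trans (card-cong (shift x X ⊕ S) (shift x (X ⊕ S)) (shift-⊕ x X S)) (card-shift x (X ⊕ S))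

  shift-⊆-⊕ : ∀ {S s} A → s ∈ S → shift s A ⊆ A ⊕ S
  shift-⊆-⊕ {s = s} A s∈S p = let a , a∈A , z≈ = ∈-shift⁻ p in
    ∈-resp (≈-sym (≈-trans z≈ (+-comm s a))) (∈-⊕⁺ a∈A s∈S)

  card-≤-⊕ˡ : ∀ X {S s} → s ∈ S → ∣ X ∣ ≤ ∣ X ⊕ S ∣
  card-≤-⊕ˡ X {S} {s} s∈S = ≡.subst (_≤ ∣ X ⊕ S ∣) (card-shift s X)
    (card-mono (shift s X) (X ⊕ S) (shift-⊆-⊕ X s∈S))

  card-≤-⊕ʳ : ∀ {X x} S → x ∈ X → ∣ S ∣ ≤ ∣ X ⊕ S ∣
  card-≤-⊕ʳ {X} {x} S x∈X = ≡.subst (_≤ ∣ X ⊕ S ∣) (card-shift x S)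
    (card-mono (shift x S) (X ⊕ S) λ p → let y , y∈S , z≈ = ∈-shift⁻ p in
      ∈-resp (≈-sym z≈) (∈-⊕⁺ x∈X y∈S))

  ++-⊕ : ∀ X Y S → (X ++ Y) ⊕ S ≋ (X ⊕ S) ++ (Y ⊕ S)
  ++-⊕ X Y S = to , from
    where
    to : (X ++ Y) ⊕ S ⊆ (X ⊕ S) ++ (Y ⊕ S)
    to p with ∈-⊕⁻ (X ++ Y) S p
    ... | z , s , z∈ , s∈S , w≈ with ∈-++⁻ X z∈
    ... | inj₁ z∈X = ∈-resp (≈-sym w≈) (∈-++⁺ˡ {X ⊕ S} (∈-⊕⁺ z∈X s∈S))
    ... | inj₂ z∈Y = ∈-resp (≈-sym w≈) (∈-++⁺ʳ (X ⊕ S) (∈-⊕⁺ z∈Y s∈S))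
    from : (X ⊕ S) ++ (Y ⊕ S) ⊆ (X ++ Y) ⊕ S
    from p with ∈-++⁻ (X ⊕ S) p
    ... | inj₁ q = ⊕-monoˡ X (X ++ Y) S ∈-++⁺ˡ q
    ... | inj₂ q = ⊕-monoˡ Y (X ++ Y) S (∈-++⁺ʳ X) q

  -- Adding `S` commutes with unions, whereas the sum of an intersection with `S` is only contained
  -- in the intersection of the sums.
  ∣⊕∣-submodular : ∀ X Y S →
    ∣ (X ++ Y) ⊕ S ∣ ℕ.+ ∣ (X ∩ Y) ⊕ S ∣ ≤ ∣ X ⊕ S ∣ ℕ.+ ∣ Y ⊕ S ∣
  ∣⊕∣-submodular X Y S = begin
    ∣ (X ++ Y) ⊕ S ∣ ℕ.+ ∣ (X ∩ Y) ⊕ S ∣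
      ≤⟨ ℕ.+-mono-≤ (ℕ.≤-reflexive (card-cong ((X ++ Y) ⊕ S) ((X ⊕ S) ++ (Y ⊕ S)) (++-⊕ X Y S)))
                    (card-mono ((X ∩ Y) ⊕ S) ((X ⊕ S) ∩ (Y ⊕ S)) λ p →
                      ∈-∩⁺ (⊕-monoˡ (X ∩ Y) X S (proj₁ ∘ ∈-∩⁻) p)
                           (⊕-monoˡ (X ∩ Y) Y S (proj₂ ∘ ∈-∩⁻ {X}) p)) ⟩
    ∣ (X ⊕ S) ++ (Y ⊕ S) ∣ ℕ.+ ∣ (X ⊕ S) ∩ (Y ⊕ S) ∣  ≡⟨ card-∪-∩ (X ⊕ S) (Y ⊕ S) ⟩
    ∣ X ⊕ S ∣ ℕ.+ ∣ Y ⊕ S ∣ ∎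
    where open ℕ.≤-Reasoning

  -- Sets that miss at least two points.

  -- Expresses |X| ≤ |G| - 2 without mentioning |G|, so that finite and infinite groups are treated
  -- alike.
  TwoOutside : FinSet → Set (c ⊔ ℓ)
  TwoOutside X = ∃₂ λ g h → ¬ g ≈ h × g ∉ X × h ∉ X

  TwoOutside-⊆ : ∀ X Y → X ⊆ Y → TwoOutside Y → TwoOutside X
  TwoOutside-⊆ X Y X⊆Y (g , h , g≉h , g∉Y , h∉Y) =
    g , h , g≉h , (λ p → g∉Y (X⊆Y p)) , λ p → h∉Y (X⊆Y p)

  TwoOutside⇒¬IsWhole : ∀ {X} → TwoOutside X → ¬ IsWhole X
  TwoOutside⇒¬IsWhole (g , _ , _ , g∉X , _) whole = g∉X (whole g)

  whole-≤ : ∀ {W X} → IsWhole W → ¬ TwoOutside X → ∣ W ∣ ≤ suc ∣ X ∣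
  whole-≤ {W} {X} whole ¬two = begin
    ∣ W ∣                ≤⟨ card-mono W (X ++ W) (∈-++⁺ʳ X) ⟩
    ∣ X ++ W ∣           ≡⟨ card-∪-∖ X W ⟩
    ∣ X ∣ ℕ.+ ∣ W ∖ X ∣  ≤⟨ ℕ.+-monoʳ-≤ ∣ X ∣ (ℕ.≮⇒≥ λ 2≤ →
      let x , y , x∈ , y∈ , x≉y = 2≤card⁻ {W ∖ X} 2≤ in
      ¬two (x , y , x≉y , proj₂ (∈-∖⁻ {W} x∈) , proj₂ (∈-∖⁻ {W} y∈))) ⟩
    ∣ X ∣ ℕ.+ 1          ≡⟨ ℕ.+-comm ∣ X ∣ 1 ⟩
    suc ∣ X ∣            ∎
    where open ℕ.≤-Reasoning

  +2-≤-whole : ∀ {W X} → IsWhole W → TwoOutside X → 2 ℕ.+ ∣ X ∣ ≤ ∣ W ∣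
  +2-≤-whole {W} {X} whole (g , h , g≉h , g∉X , h∉X) = begin
    2 ℕ.+ ∣ X ∣                    ≡⟨ ≡.cong (ℕ._+ ∣ X ∣) (card-pair g≉h) ⟨
    ∣ g ∷ h ∷ [] ∣ ℕ.+ ∣ X ∣       ≡⟨ card-⊎ {g ∷ h ∷ []} (λ
      { (here z≈g) → ∉-resp (≈-sym z≈g) g∉X ; (there (here z≈h)) → ∉-resp (≈-sym z≈h) h∉X }) ⟨
    ∣ (g ∷ h ∷ []) ++ X ∣          ≤⟨ card-mono (g ∷ h ∷ X) W (λ {x} _ → whole x) ⟩
    ∣ W ∣                          ∎
    where open ℕ.≤-Reasoning

  TwoOutside-shift : ∀ x X → TwoOutside X → TwoOutside (shift x X)
  TwoOutside-shift x X (g , h , g≉h , g∉X , h∉X) =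
    x + g , x + h , (λ p → g≉h (+-cancelˡ x _ _ p)) , out g∉X , out h∉X
    where
    out : ∀ {g} → g ∉ X → x + g ∉ shift x X
    out {g} g∉X p = g∉X (∈-resp (identity! (v0 :+ v1 :+ :- v0) v1 (x ∷ g ∷ [])) (∈-shift⁻′ p))

  whole-if-cofinite : ∀ {X} → ¬ TwoOutside X → ∃[ W ] IsWhole W
  whole-if-cofinite {X} ¬two = by-outside (dec (∃[ g ] g ∉ X))
    where
    by-outside : Dec (∃[ g ] g ∉ X) → ∃[ W ] IsWhole W
    by-outside (no none) = X , λ g → by-contradiction λ g∉X → none (g , g∉X)
    by-outside (yes (g , g∉X)) = g ∷ X , λ h → by-contradiction λ h∉ →
      ¬two (g , h , (λ g≈h → h∉ (here (≈-sym g≈h))) , g∉X , h∉ ∘ there)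

  -- A set missing at most one point has at least |G| - 1 elements; in an infinite group every
  -- finite set misses two points.
  min-≤ : ∀ {X n} → (TwoOutside X → n ≤ ∣ X ∣) → min (pred⁺ ∣G∣) n ≤ ∣ X ∣
  min-≤ {X} {n} large with em {∃[ W ] IsWhole W}
  ... | yes (W , whole) = by-room (dec (TwoOutside X))
    where
    by-room : Dec (TwoOutside X) → pred ∣ W ∣ ℕ.⊓ n ≤ ∣ X ∣
    by-room (yes room) = ℕ.≤-trans (ℕ.m⊓n≤n (pred ∣ W ∣) n) (large room)
    by-room (no ¬room) = ℕ.≤-trans (ℕ.m⊓n≤m (pred ∣ W ∣) n) (ℕ.pred-mono-≤ (whole-≤ {W} {X} whole ¬room))
  ... | no infinite = large (by-contradiction λ ¬two → infinite (whole-if-cofinite {X} ¬two))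

  singleton-progression : ∀ {S s₀} → s₀ ∈ S → ¬ 2 ≤ ∣ S ∣ → IsArithmeticProgression S
  singleton-progression {S} {s₀} s₀∈S ¬2≤ = s₀ , 0# , 1 , s≤s z≤n ,
    (λ {x} x∈S → here (near-s₀ x∈S)) ,
    λ { (here x≈) → ∈-resp (≈-sym (≈-trans x≈ (+-identityʳ s₀))) s₀∈S }
    where
    near-s₀ : ∀ {x} → x ∈ S → x ≈ s₀ + 0#
    near-s₀ {x} x∈S with x ≟ (s₀ + 0#)
    ... | yes eq = eq
    ... | no x≉ = contradiction (2≤card {S} x∈S s₀∈S λ x≈ → x≉ (≈-trans x≈ (≈-sym (+-identityʳ s₀)))) ¬2≤

  -- Stabilisers, and membership in progressions.

  Stabilises : Carrier → FinSet → Set (c ⊔ ℓ)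
  Stabilises x R = ∀ y → y ∈ R → x + y ∈ R

  stabilises-resp : ∀ {R x x′} → x ≈ x′ → Stabilises x R → Stabilises x′ R
  stabilises-resp x≈ st y y∈ = ∈-resp (+-congʳ x≈) (st y y∈)

  -- For non-empty `R` this is the full stabiliser: if x + R is contained in R, then x = (x + r) - r
  -- lies in R - R. Searching only there makes it a finite list.
  stab : FinSet → FinSet
  stab R = select (λ x → Stabilises x R) (R ⊖ R)

  ∈-stab⁺ : ∀ {R r x} → r ∈ R → Stabilises x R → x ∈ stab R
  ∈-stab⁺ {R} {r} {x} r∈ st = ∈-select⁺ stabilises-resp
    (∈-resp (identity! (v0 :+ v1 :+ :- v1) v0 (x ∷ r ∷ [])) (∈-⊖⁺ (st r r∈) r∈)) st

  ∈-stab⁻ : ∀ {R x} → x ∈ stab R → Stabilises x R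
  ∈-stab⁻ {R} x∈ = proj₂ (∈-select⁻ {λ x → Stabilises x R} {R ⊖ R} stabilises-resp x∈)

  -- An injective self-map of a finite set is onto.
  stabilises-neg : ∀ {R x} → Stabilises x R → Stabilises (- x) R
  stabilises-neg {R} {x} st y y∈R = ∈-resp (+-comm y (- x)) (∈-shift⁻′ {x} {R}
    (⊆∧≥⇒⊇ {shift x R} {R}
      (λ p → let z , z∈ , eq = ∈-shift⁻ p in ∈-resp (≈-sym eq) (st z z∈))
      (ℕ.≤-reflexive (≡.sym (card-shift x R))) y∈R))

  stab-subgroup : ∀ {R r} → r ∈ R → IsSubgroup (stab R)
  stab-subgroup {R} r∈R = record
    { 0∈ = ∈-stab⁺ r∈R λ y → ∈-resp (≈-sym (+-identityˡ y))
    ; +∈ = λ {x} {y} x∈ y∈ → ∈-stab⁺ r∈R λ z z∈ →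
             ∈-resp (≈-sym (+-assoc x y z)) (∈-stab⁻ x∈ (y + z) (∈-stab⁻ y∈ z z∈))
    ; -∈ = λ x∈ → ∈-stab⁺ r∈R (stabilises-neg (∈-stab⁻ x∈))
    }

  -- The coset of the stabiliser through `r` is contained in `R`.
  card-stab-≤ : ∀ {R r} → r ∈ R → ∣ stab R ∣ ≤ ∣ R ∣
  card-stab-≤ {R} {r} r∈R = ≡.subst (_≤ ∣ R ∣) (card-shift r (stab R))
    (card-mono (shift r (stab R)) R λ p → let k , k∈ , eq = ∈-shift⁻ p in
      ∈-resp (≈-sym (≈-trans eq (+-comm r k))) (∈-stab⁻ k∈ r r∈R))

  ∈-progression⁺ : ∀ a d {m i} → i < m → a + i ×ᴳ d ∈ progression a d m
  ∈-progression⁺ a d = Mem.∈-applyUpTo⁺ setoid (λ i → a + i ×ᴳ d)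

  ∈-progression⁻ : ∀ a d {m x} → x ∈ progression a d m → ∃[ i ] (i < m × x ≈ a + i ×ᴳ d)
  ∈-progression⁻ a d = Mem.∈-applyUpTo⁻ setoid (λ i → a + i ×ᴳ d)

  -- Fragments and atoms when the hyper-atom is zero.

  module Fragments
    (S : FinSet)
    -- `bound` says that κ₁(S) is at least |S| - 1, and `aperiodic` that a subgroup whose excess is
    -- at most |S| - 1 is zero or has sum G with S.
    (bound : ∀ X → NonEmpty X → ¬ IsWhole (X ⊕ S) → ∣ X ∣ ℕ.+ ∣ S ∣ ≤ suc ∣ X ⊕ S ∣)
    (aperiodic : ∀ K → IsSubgroup K → ¬ IsWhole (K ⊕ S) → ∣ K ⊕ S ∣ < ∣ K ∣ ℕ.+ ∣ S ∣ →
                 ∀ {k} → k ∈ K → k ≈ 0#)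
    where

    -- Together with `bound`, the field `thin` means |X + S| = |X| + |S| - 1. These are the sets
    -- violating the inequality |X + S| ≥ |X| + |S| that is to be proved when S is not a
    -- progression.
    record TwoFragment (X : FinSet) : Set (c ⊔ ℓ) where
      field
        2≤   : 2 ≤ ∣ X ∣
        room : TwoOutside (X ⊕ S)
        thin : ∣ X ⊕ S ∣ < ∣ X ∣ ℕ.+ ∣ S ∣

      non-empty : NonEmpty X
      non-empty = 1≤card⁻ (ℕ.≤-trans (s≤s z≤n) 2≤)

      non-whole : ¬ IsWhole (X ⊕ S)
      non-whole = TwoOutside⇒¬IsWhole {X ⊕ S} room

      tight : ∣ X ∣ ℕ.+ ∣ S ∣ ≤ suc ∣ X ⊕ S ∣
      tight = bound X non-empty non-whole

    open TwoFragment

    TwoAtom : FinSet → Set (c ⊔ ℓ)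
    TwoAtom A = TwoFragment A × (∀ X → TwoFragment X → ∣ A ∣ ≤ ∣ X ∣)

    shift-fragment : ∀ x {X} → TwoFragment X → TwoFragment (shift x X)
    shift-fragment x {X} frag = record
      { 2≤   = ≡.subst (2 ≤_) (≡.sym (card-shift x X)) (2≤ frag)
      ; room = TwoOutside-⊆ (shift x X ⊕ S) (shift x (X ⊕ S)) (proj₁ (shift-⊕ x X S))
                 (TwoOutside-shift x (X ⊕ S) (room frag))
      ; thin = ≡.subst₂ (λ m n → m < n ℕ.+ ∣ S ∣) (≡.sym (card-shift-⊕ x X S)) (≡.sym (card-shift x X))
                 (thin frag)
      }

    shift-atom : ∀ x {A} → TwoAtom A → TwoAtom (shift x A)
    shift-atom x {A} (frag , least) =
      shift-fragment x frag , λ X f → ≡.subst (_≤ ∣ X ∣) (≡.sym (card-shift x A)) (least X f)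

    -- The fragment is the negated complement of F + S: its sum with S misses - F.
    dual-fragment : ∀ {W F} → IsWhole W → TwoFragment F →
           ∃[ Y ] (TwoFragment Y × ∣ Y ∣ ℕ.+ ∣ F ⊕ S ∣ ≡ ∣ W ∣)
    dual-fragment {W} {F} whole frag = Y , frag-Y , card-Y
      where
      Y = opp (W ∖ (F ⊕ S))

      ∈Y : ∀ {g} → g ∉ F ⊕ S → - g ∈ Y
      ∈Y g∉ = ∈-opp⁺ (∈-∖⁺ (whole _) g∉)

      card-Y : ∣ Y ∣ ℕ.+ ∣ F ⊕ S ∣ ≡ ∣ W ∣
      card-Y = begin-equality
        ∣ Y ∣ ℕ.+ ∣ F ⊕ S ∣                ≡⟨ ≡.cong (ℕ._+ ∣ F ⊕ S ∣) (card-opp (W ∖ (F ⊕ S))) ⟩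
        ∣ W ∖ (F ⊕ S) ∣ ℕ.+ ∣ F ⊕ S ∣      ≡⟨ ℕ.+-comm _ ∣ F ⊕ S ∣ ⟩
        ∣ F ⊕ S ∣ ℕ.+ ∣ W ∖ (F ⊕ S) ∣      ≡⟨ card-∪-∖ (F ⊕ S) W ⟨
        ∣ (F ⊕ S) ++ W ∣                   ≡⟨ card-cong ((F ⊕ S) ++ W) W ((λ _ → whole _) , ∈-++⁺ʳ (F ⊕ S)) ⟩
        ∣ W ∣                              ∎
        where open ℕ.≤-Reasoning

      Y⊕S# : ∀ {f} → f ∈ F → - f ∉ Y ⊕ S
      Y⊕S# {f} f∈F p with ∈-⊕⁻ Y S p
      ... | y , s , y∈Y , s∈S , eq with ∈-opp⁻ y∈Y
      ... | z , z∈ , y≈ = proj₂ (∈-∖⁻ {W} z∈) (∈-resp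
        (-‿injective (≈-trans (identity! (:- (v0 :+ v1)) (:- v0 :+ :- v1) (f ∷ s ∷ []))
          (≈-trans (+-congʳ eq) (≈-trans (identity! (v0 :+ v1 :+ :- v1) v0 (y ∷ s ∷ [])) y≈))))
        (∈-⊕⁺ f∈F s∈S))

      frag-Y : TwoFragment Y
      frag-Y = record
        { 2≤ = let g , h , g≉h , g∉ , h∉ = room frag in
               2≤card (∈Y g∉) (∈Y h∉) (g≉h ∘ -‿injective)
        ; room = let f , f′ , f∈ , f′∈ , f≉f′ = 2≤card⁻ {F} (2≤ frag) in
                 - f , - f′ , f≉f′ ∘ -‿injective , Y⊕S# f∈ , Y⊕S# f′∈
        ; thin = dual-arith (∣ Y ∣) (∣ F ⊕ S ∣) (∣ W ∣) (∣ F ∣) (∣ Y ⊕ S ∣) (∣ S ∣) card-Y (begin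
            ∣ Y ⊕ S ∣ ℕ.+ ∣ F ∣      ≡⟨ ≡.cong (∣ Y ⊕ S ∣ ℕ.+_) (card-opp F) ⟨
            ∣ Y ⊕ S ∣ ℕ.+ ∣ opp F ∣  ≡⟨ card-⊎ {Y ⊕ S} {opp F} (λ x∈ x∈F → let f , f∈ , x≈ = ∈-opp⁻ x∈F in
                                          Y⊕S# f∈ (∈-resp x≈ x∈)) ⟨
            ∣ (Y ⊕ S) ++ opp F ∣     ≤⟨ card-mono ((Y ⊕ S) ++ opp F) W (λ _ → whole _) ⟩
            ∣ W ∣                    ∎) (thin frag)
        }
        where open ℕ.≤-Reasoning

    -- By minimality of `A` its proper subset `A ∩ F` is not thin, so submodularity gives |(A ∪ F) +
    -- S| ≤ |A ∪ F| + |S| - 2. This violates `bound` unless the sum is all of G. `F` is only taken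
    -- to be thin because `atom-≤2` applies this before knowing that its union F has room.
    atom-absorbed : ∀ {A F} → TwoAtom A → ∣ F ⊕ S ∣ < ∣ F ∣ ℕ.+ ∣ S ∣ → 2 ≤ ∣ A ∩ F ∣ → ¬ A ⊆ F →
      IsWhole ((A ++ F) ⊕ S) × 2 ℕ.+ ∣ (A ++ F) ⊕ S ∣ ≤ ∣ A ++ F ∣ ℕ.+ ∣ S ∣
    atom-absorbed {A} {F} (fragA , least) thinF 2≤∩ A⊈F = whole , thin-∪
      where
      ∩<A : ∣ A ∩ F ∣ < ∣ A ∣
      ∩<A = ℕ.≰⇒> λ A≤ → A⊈F (proj₂ ∘ ∈-∩⁻ {A} ∘ ⊆∧≥⇒⊇ {A ∩ F} (proj₁ ∘ ∈-∩⁻) A≤)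
      thick-∩ : ∣ A ∩ F ∣ ℕ.+ ∣ S ∣ ≤ ∣ (A ∩ F) ⊕ S ∣
      thick-∩ = ℕ.≮⇒≥ λ thin-∩ → ℕ.<⇒≱ ∩<A (least (A ∩ F) (record
        { 2≤ = 2≤∩ ; thin = thin-∩
        ; room = TwoOutside-⊆ ((A ∩ F) ⊕ S) (A ⊕ S) (⊕-monoˡ (A ∩ F) A S (proj₁ ∘ ∈-∩⁻)) (room fragA) }))
      thin-∪ : 2 ℕ.+ ∣ (A ++ F) ⊕ S ∣ ≤ ∣ A ++ F ∣ ℕ.+ ∣ S ∣
      thin-∪ = absorb-arith (∣ A ∣) (∣ F ∣) (∣ A ∩ F ∣) (∣ A ++ F ∣) (∣ A ⊕ S ∣) (∣ F ⊕ S ∣)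
        (∣ (A ∩ F) ⊕ S ∣) (∣ (A ++ F) ⊕ S ∣) (∣ S ∣)
        (thin fragA) thinF thick-∩ (∣⊕∣-submodular A F S) (card-∪-∩ A F)
      whole : IsWhole ((A ++ F) ⊕ S)
      whole with dec (IsWhole ((A ++ F) ⊕ S))
      ... | yes w = w
      ... | no ¬w = contradiction
        (bound (A ++ F) (let a , a∈ = non-empty fragA in a , ∈-++⁺ˡ a∈) ¬w)
        (ℕ.<⇒≱ thin-∪)

    -- Otherwise G is finite and the dual of `F` is a fragment of size |G| - |F + S|. Since |G| ≤ |A
    -- ∪ F| + |S| - 2 and |F + S| ≥ |F| + |S| - 1, this size is less than |A|, against minimality.
    atom⊆fragment : ∀ {A F} → TwoAtom A → TwoFragment F → 2 ≤ ∣ A ∩ F ∣ → A ⊆ F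
    atom⊆fragment {A} {F} atom frag 2≤∩ with dec (A ⊆ F)
    ... | yes A⊆F = A⊆F
    ... | no  A⊈F with atom-absorbed {A} {F} atom (thin frag) 2≤∩ A⊈F
    ... | whole , thin-∪ with dual-fragment {(A ++ F) ⊕ S} whole frag
    ... | Y , fragY , card-Y = contradiction 2≤∩
      (frag-absorb-arith (∣ A ∣) (∣ F ∣) (∣ A ∩ F ∣) (∣ A ++ F ∣) (∣ F ⊕ S ∣) (∣ S ∣)
        (∣ (A ++ F) ⊕ S ∣) (∣ Y ∣)
        (proj₂ atom Y fragY) card-Y thin-∪ (tight frag) (card-∪-∩ A F))

    -- If x + A = A with 0 ∈ A then A and b + A share the points b and x + b
    -- for each b ∈ A, so that A = b + A and A is a subgroup.
    atom-not-periodic : ∀ {A x} → TwoAtom A → 0# ∈ A → ¬ x ≈ 0# → ¬ A ⊆ shift x A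
    atom-not-periodic {A} {x} atom@(frag , _) 0∈A x≉0 A⊆x+A =
      x≉0 (aperiodic A A-subgroup (non-whole frag) (thin frag) x∈A)
      where
      ⊆A : ∀ b → A ⊆ shift b A → shift b A ⊆ A
      ⊆A b A⊆ = ⊆∧≥⇒⊇ {A} A⊆ (ℕ.≤-reflexive (card-shift b A))
      x+∈A : ∀ {b} → b ∈ A → x + b ∈ A
      x+∈A b∈A = ⊆A x A⊆x+A (∈-shift⁺ b∈A)
      x∈A : x ∈ A
      x∈A = ∈-resp (+-identityʳ x) (x+∈A 0∈A)
      A⊆b+A : ∀ {b} → b ∈ A → A ⊆ shift b A
      A⊆b+A {b} b∈A = atom⊆fragment {A} {shift b A} atom (shift-fragment b frag)
        (2≤card {A ∩ shift b A} {b} {x + b}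
          (∈-∩⁺ b∈A (∈-shift⁺′ (∈-resp (≈-sym (+-inverseʳ b)) 0∈A)))
          (∈-∩⁺ (x+∈A b∈A) (∈-shift⁺′ (∈-resp (identity! v0 (v0 :+ v1 :+ :- v1) (x ∷ b ∷ [])) x∈A)))
          (λ b≈x+b → x≉0 (+-cancelʳ b x 0# (≈-trans (≈-sym b≈x+b) (≈-sym (+-identityˡ b))))))
      A-subgroup : IsSubgroup A
      A-subgroup = record
        { 0∈ = 0∈A
        ; +∈ = λ {b} b∈A y∈A → ⊆A b (A⊆b+A b∈A) (∈-shift⁺ y∈A)
        ; -∈ = λ {b} b∈A → ∈-resp (+-identityˡ (- b)) (∈-shift⁻′ (A⊆b+A b∈A 0∈A))
        }

    -- Two common points would put x + A inside y + A. The translate of `A` by `- p`, which contains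
    -- 0, would then be periodic with the non-zero period y - x.
    atom-sidon : ∀ {A x y} → TwoAtom A → ¬ x ≈ y → ∣ shift x A ∩ shift y A ∣ ≤ 1
    atom-sidon {A} {x} {y} atom@(frag , _) x≉y = ℕ.≮⇒≥ λ 2≤∩ →
      let p , p∈A = non-empty frag
          d = y + (- x)
          x+A⊆y+A = atom⊆fragment {shift x A} {shift y A} (shift-atom x atom) (shift-fragment y frag) 2≤∩
      in atom-not-periodic {shift (- p) A} {d} (shift-atom (- p) atom)
        (∈-resp (+-inverseˡ p) (∈-shift⁺ p∈A))
        (λ d≈0 → x≉y (≈-trans (≈-sym (+-identityˡ x)) (≈-trans (+-congʳ (≈-sym d≈0))
          (identity! (v0 :+ :- v1 :+ v1) v0 (y ∷ x ∷ [])))))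
        (λ {z} z∈ → ∈-shift⁺′ (∈-shift⁺′ (∈-resp
          (identity! (v0 :+ (v1 :+ :- (:- v2)) :+ :- v3) (v1 :+ :- (v3 :+ :- v0) :+ :- (:- v2))
            (x ∷ z ∷ p ∷ y ∷ []))
          (∈-shift⁻′ (x+A⊆y+A (∈-shift⁺ {x} (∈-shift⁻′ z∈)))))))

    -- The translate by `x` is the union of its intersections with the other two, each of at most
    -- one point.
    atom-covered : ∀ {A x y z} → TwoAtom A → ¬ x ≈ y → ¬ x ≈ z →
                   shift x A ⊆ shift y A ++ shift z A → ∣ A ∣ ≤ 2
    atom-covered {A} {x} {y} {z} atom x≉y x≉z cover = begin
      ∣ A ∣                        ≡⟨ card-shift x A ⟨
      ∣ P ∣                        ≤⟨ card-mono P ((P ∩ Q) ++ (P ∩ R)) split ⟩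
      ∣ (P ∩ Q) ++ (P ∩ R) ∣       ≤⟨ card-∪-≤ (P ∩ Q) (P ∩ R) ⟩
      ∣ P ∩ Q ∣ ℕ.+ ∣ P ∩ R ∣      ≤⟨ ℕ.+-mono-≤ (atom-sidon atom x≉y) (atom-sidon atom x≉z) ⟩
      2                            ∎
      where
      open ℕ.≤-Reasoning
      P = shift x A
      Q = shift y A
      R = shift z A
      split : P ⊆ (P ∩ Q) ++ (P ∩ R)
      split p with ∈-++⁻ Q (cover p)
      ... | inj₁ q = ∈-++⁺ˡ (∈-∩⁺ p q)
      ... | inj₂ r = ∈-++⁺ʳ (P ∩ Q) (∈-∩⁺ p r)

    -- For distinct b, c, e ∈ A the translates A + c - e and A + b - e meet in
    -- one point, so their union F is thin. As F meets A in b and c but cannot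
    -- contain A, the complement of F + S has at most one element. This forces
    -- |S| ≤ |A|; but then A + S is already the union of two translates of A,
    -- and a third translate cannot be covered by them.
    atom-≤2 : ∀ {A T} → TwoAtom A → TwoFragment T → ∣ S ∣ ≤ ∣ T ∣ → 2 ≤ ∣ S ∣ → ∣ A ∣ ≤ 2
    atom-≤2 {A} {T} atom@(frag , least) fragT S≤T 2≤S =
      ℕ.≮⇒≥ λ 3≤A → let b , c , e , b∈ , c∈ , e∈ , b≉c , b≉e , c≉e = 3≤card⁻ {A} 3≤A in
        case 3≤A b c e b∈ c∈ e∈ b≉c b≉e c≉e
      where
      open ℕ.≤-Reasoning

      union-card : ∀ {x y} → ¬ x ≈ y → ∣ A ∣ ℕ.+ ∣ A ∣ ≤ suc ∣ shift x A ++ shift y A ∣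
      union-card {x} {y} x≉y = begin
        ∣ A ∣ ℕ.+ ∣ A ∣          ≡⟨ ≡.cong₂ ℕ._+_ (card-shift x A) (card-shift y A) ⟨
        ∣ P ∣ ℕ.+ ∣ Q ∣          ≡⟨ card-∪-∩ P Q ⟨
        ∣ P ++ Q ∣ ℕ.+ ∣ P ∩ Q ∣ ≤⟨ ℕ.+-monoʳ-≤ ∣ P ++ Q ∣ (atom-sidon atom x≉y) ⟩
        ∣ P ++ Q ∣ ℕ.+ 1         ≡⟨ ℕ.+-comm ∣ P ++ Q ∣ 1 ⟩
        suc ∣ P ++ Q ∣           ∎
        where
        P = shift x A
        Q = shift y A

      two-⊆ : ∀ {s t} → s ∈ S → t ∈ S → shift s A ++ shift t A ⊆ A ⊕ S
      two-⊆ {s} {t} s∈ t∈ p with ∈-++⁻ (shift s A) p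
      ... | inj₁ q = shift-⊆-⊕ A s∈ q
      ... | inj₂ q = shift-⊆-⊕ A t∈ q

      -- A + S contains two translates of A, hence at least 2|A| - 1 elements, but has at most |A| +
      -- |S| - 1.
      A≤S : ∣ A ∣ ≤ ∣ S ∣
      A≤S with 2≤card⁻ {S} 2≤S
      ... | s , t , s∈ , t∈ , s≉t = ℕ.+-cancelˡ-≤ ∣ A ∣ _ _ (begin
        ∣ A ∣ ℕ.+ ∣ A ∣                 ≤⟨ union-card s≉t ⟩
        suc ∣ shift s A ++ shift t A ∣  ≤⟨ s≤s (card-mono (shift s A ++ shift t A) (A ⊕ S) (two-⊆ s∈ t∈)) ⟩
        suc ∣ A ⊕ S ∣                   ≤⟨ thin frag ⟩
        ∣ A ∣ ℕ.+ ∣ S ∣                 ∎)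

      not-small : 3 ≤ ∣ A ∣ → ¬ ∣ S ∣ ≤ ∣ A ∣
      not-small 3≤A S≤A =
        -- Three elements of S are available because 3 ≤ |A| ≤ |S|.
        let s , t , u , s∈ , t∈ , u∈ , s≉t , s≉u , t≉u = 3≤card⁻ {S} (ℕ.≤-trans 3≤A A≤S) in
        ℕ.<⇒≱ 3≤A (atom-covered {A} {u} {s} {t} atom (s≉u ∘ ≈-sym) (t≉u ∘ ≈-sym) λ p →
          ⊆∧≥⇒⊇ {shift s A ++ shift t A} {A ⊕ S} (two-⊆ s∈ t∈) (ℕ.s≤s⁻¹ (begin
              suc ∣ A ⊕ S ∣                   ≤⟨ thin frag ⟩
              ∣ A ∣ ℕ.+ ∣ S ∣                 ≤⟨ ℕ.+-monoʳ-≤ ∣ A ∣ S≤A ⟩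
              ∣ A ∣ ℕ.+ ∣ A ∣                 ≤⟨ union-card s≉t ⟩
              suc ∣ shift s A ++ shift t A ∣  ∎))
            (shift-⊆-⊕ A u∈ p))

      case : 3 ≤ ∣ A ∣ → ∀ b c e → b ∈ A → c ∈ A → e ∈ A → ¬ b ≈ c → ¬ b ≈ e → ¬ c ≈ e → ⊥
      case 3≤A b c e b∈ c∈ e∈ b≉c b≉e c≉e = A⊈F A⊆F
        where
        -- As `e` lies in A, the translate `P` contains `c` and `Q` contains `b`; both contain b + c
        -- - e.
        P = shift (c + (- e)) A
        Q = shift (b + (- e)) A
        F = P ++ Q

        -ᵉ-inj : ∀ {x y} → x + (- e) ≈ y + (- e) → x ≈ y
        -ᵉ-inj = +-cancelʳ (- e) _ _

        0≉ : ∀ {x} → ¬ x ≈ e → ¬ 0# ≈ x + (- e)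
        0≉ x≉e 0≈ = x≉e (-ᵉ-inj (≈-trans (≈-sym 0≈) (≈-sym (+-inverseʳ e))))

        ∈shift : ∀ {x} → x ∈ shift (x + (- e)) A
        ∈shift {x} = ∈-shift⁺′ (∈-resp (identity! v1 (v0 :+ :- (v0 :+ :- v1)) (x ∷ e ∷ [])) e∈)

        meet : (b + c) + (- e) ∈ P ∩ Q
        meet = ∈-∩⁺
          (∈-resp (identity! (v1 :+ :- v2 :+ v0) (v0 :+ v1 :+ :- v2) (b ∷ c ∷ e ∷ [])) (∈-shift⁺ b∈))
          (∈-resp (identity! (v0 :+ :- v2 :+ v1) (v0 :+ v1 :+ :- v2) (b ∷ c ∷ e ∷ [])) (∈-shift⁺ c∈))

        card-F : ∣ F ∣ ℕ.+ ∣ P ∩ Q ∣ ≡ ∣ A ∣ ℕ.+ ∣ A ∣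
        card-F = ≡.trans (card-∪-∩ P Q)
          (≡.cong₂ ℕ._+_ (card-shift (c + (- e)) A) (card-shift (b + (- e)) A))

        thin-F : ∣ F ⊕ S ∣ < ∣ F ∣ ℕ.+ ∣ S ∣
        thin-F = union-arith (∣ A ∣) (∣ F ∣) (∣ P ∩ Q ∣) (∣ A ⊕ S ∣) (∣ F ⊕ S ∣) (∣ (P ∩ Q) ⊕ S ∣) (∣ S ∣)
          (≡.subst (∣ F ⊕ S ∣ ℕ.+ ∣ (P ∩ Q) ⊕ S ∣ ≤_)
            (≡.cong₂ ℕ._+_ (card-shift-⊕ (c + (- e)) A S) (card-shift-⊕ (b + (- e)) A S))
            (∣⊕∣-submodular P Q S))
          (thin frag) (card-≤-⊕ʳ {P ∩ Q} S meet) card-F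
          (atom-sidon atom (b≉c ∘ ≈-sym ∘ -ᵉ-inj))

        2≤∩ : 2 ≤ ∣ A ∩ F ∣
        2≤∩ = 2≤card {A ∩ F} (∈-∩⁺ b∈ (∈-++⁺ʳ P ∈shift)) (∈-∩⁺ c∈ (∈-++⁺ˡ ∈shift)) b≉c

        A⊈F : ¬ A ⊆ F
        A⊈F A⊆F = ℕ.<⇒≱ 3≤A (atom-covered {A} {0#} atom (0≉ c≉e) (0≉ b≉e) λ p →
          A⊆F (let a , a∈A , z≈ = ∈-shift⁻ p in ∈-resp (≈-sym (≈-trans z≈ (+-identityˡ a))) a∈A))

        W = (A ++ F) ⊕ S

        whole : IsWhole W
        whole = proj₁ (atom-absorbed {A} {F} atom thin-F 2≤∩ A⊈F)

        room-F : TwoOutside (F ⊕ S)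
        -- Without room, |G| ≤ |F + S| + 1 ≤ 2|A| + |S| - 1. The dual of T has |G| - |T + S| ≤ |G| -
        -- 2|S| + 1 elements, and at least |A| by minimality; hence |S| ≤ |A|.
        room-F = by-contradiction λ ¬room → let Y , fragY , card-Y = dual-fragment {W} {T} whole fragT in
          not-small 3≤A (small-arith (∣ A ∣) (∣ F ∣) (∣ P ∩ Q ∣) (∣ F ⊕ S ∣) (∣ S ∣)
            (∣ W ∣) (∣ Y ∣) (∣ T ∣) (∣ T ⊕ S ∣)
            (whole-≤ {W} {F ⊕ S} whole ¬room) thin-F card-F (1≤card {P ∩ Q} (_ , meet))
            (least Y fragY) card-Y (tight fragT) S≤T)

        A⊆F : A ⊆ F
        A⊆F = atom⊆fragment {A} {F} atom (record
          { 2≤ = ℕ.≤-trans 2≤∩ (card-mono (A ∩ F) F (proj₂ ∘ ∈-∩⁻ {A}))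
          ; room = room-F ; thin = thin-F }) 2≤∩

    -- A smallest fragment consists of two points p and q. With d = q - p, its sum with S is the
    -- translate by p of (d + S) ∪ S, and has at most |S| + 1 elements.
    fragment⇒almost-periodic : ∀ {T} → TwoFragment T → ∣ S ∣ ≤ ∣ T ∣ → 2 ≤ ∣ S ∣ →
      ∃[ d ] (¬ d ≈ 0# × ∣ shift d S ++ S ∣ ≤ suc ∣ S ∣)
    fragment⇒almost-periodic {T} fragT S≤T 2≤S =
      let _ , (A , fragA , A≡) , min =
            minimum em (λ n → ∃[ X ] (TwoFragment X × ∣ X ∣ ≡ n)) ∣ T ∣ (T , fragT , ≡.refl)
          p , q , p∈ , q∈ , p≉q = 2≤card⁻ {A} (2≤ fragA)
          atom = fragA , λ X f → ≡.subst (_≤ ∣ X ∣) (≡.sym A≡) (min ∣ X ∣ (X , f , ≡.refl))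
      in q + (- p)
       , (λ d≈0 → p≉q (≈-sym (+-cancelʳ (- p) q p (≈-trans d≈0 (≈-sym (+-inverseʳ p))))))
       , pair-card A p q fragA p∈ q∈ (atom-≤2 {A} {T} atom fragT S≤T 2≤S)
      where
      open ℕ.≤-Reasoning
      pair-card : ∀ A p q → TwoFragment A → p ∈ A → q ∈ A → ∣ A ∣ ≤ 2 →
                  ∣ shift (q + (- p)) S ++ S ∣ ≤ suc ∣ S ∣
      pair-card A p q fragA p∈ q∈ A≤2 = ℕ.s≤s⁻¹ (begin
        suc ∣ U ∣                ≡⟨ ≡.cong suc (card-shift p U) ⟨
        suc ∣ shift p U ∣        ≤⟨ s≤s (card-mono (shift p U) (A ⊕ S) U⊆) ⟩
        suc ∣ A ⊕ S ∣            ≤⟨ thin fragA ⟩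
        ∣ A ∣ ℕ.+ ∣ S ∣          ≤⟨ ℕ.+-monoˡ-≤ ∣ S ∣ A≤2 ⟩
        2 ℕ.+ ∣ S ∣              ∎)
        where
        d = q + (- p)
        U = shift d S ++ S
        U⊆ : shift p U ⊆ A ⊕ S
        U⊆ r with ∈-shift⁻ r
        ... | u , u∈U , z≈ with ∈-++⁻ (shift d S) u∈U
        ... | inj₂ u∈S = ∈-resp (≈-sym z≈) (∈-⊕⁺ p∈ u∈S)
        ... | inj₁ u∈d+S with ∈-shift⁻ u∈d+S
        ... | s , s∈S , u≈ = ∈-resp (≈-sym (≈-trans z≈ (≈-trans (+-congˡ u≈)
          (identity! (v0 :+ (v1 :+ :- v0 :+ v2)) (v1 :+ v2) (p ∷ q ∷ s ∷ []))))) (∈-⊕⁺ q∈ s∈S)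

    -- From an almost-period to an arithmetic progression.

    module _ (S≠G : ¬ IsWhole S) {T} (fragT : TwoFragment T) (S≤T : ∣ S ∣ ≤ ∣ T ∣) {s} (s∈S : s ∈ S)
             {d} (d≉0 : ¬ d ≈ 0#) (almost : ∣ shift d S ++ S ∣ ≤ suc ∣ S ∣) where

      -- The union of d + S and S has |S| + 1 elements at most, so at most one point of S lies
      -- outside d + S.
      start-unique : ∀ {x y} → x ∈ S → y ∈ S → x + (- d) ∉ S → y + (- d) ∉ S → x ≈ y
      start-unique {x} {y} x∈ y∈ x-d∉ y-d∉ with x ≟ y
      ... | yes x≈y = x≈y
      ... | no  x≉y = contradiction
        (2≤card {S ∖ shift d S} (∈-∖⁺ x∈ (x-d∉ ∘ ∈-shift⁻′)) (∈-∖⁺ y∈ (y-d∉ ∘ ∈-shift⁻′)) x≉y)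
        (ℕ.≤⇒≯ (ℕ.+-cancelˡ-≤ ∣ S ∣ _ _ (begin
          ∣ S ∣ ℕ.+ ∣ S ∖ shift d S ∣          ≡⟨ ≡.cong (ℕ._+ ∣ S ∖ shift d S ∣) (card-shift d S) ⟨
          ∣ shift d S ∣ ℕ.+ ∣ S ∖ shift d S ∣  ≡⟨ card-∪-∖ (shift d S) S ⟨
          ∣ shift d S ++ S ∣                   ≤⟨ almost ⟩
          suc ∣ S ∣                            ≡⟨ ℕ.+-comm 1 ∣ S ∣ ⟩
          ∣ S ∣ ℕ.+ 1                          ∎)))
        where open ℕ.≤-Reasoning

      -- Otherwise `- d` stabilises S. The stabiliser K then satisfies K + S = S, a proper subset of
      -- G, so `aperiodic` makes K zero and with it `d`.
      start : ∃[ s₀ ] (s₀ ∈ S × s₀ + (- d) ∉ S)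
      start = by-contradiction λ none →
        let stable : Stabilises (- d) S
            stable y y∈ = by-contradiction λ y-d∉ → none (y , y∈ , y-d∉ ∘ ∈-resp (+-comm y (- d)))
            K = stab S
            K⊕S⊆S : K ⊕ S ⊆ S
            K⊕S⊆S p = let k , x , k∈ , x∈ , eq = ∈-⊕⁻ K S p in ∈-resp (≈-sym eq) (∈-stab⁻ k∈ x x∈)
        in d≉0 (≈-trans (≈-sym (-‿involutive d)) (≈-trans
          (-‿cong (aperiodic K (stab-subgroup s∈S)
            (λ w → S≠G (λ g → K⊕S⊆S (w g)))
            (ℕ.≤-trans (s≤s (card-mono (K ⊕ S) S K⊕S⊆S))
              (ℕ.+-monoˡ-≤ ∣ S ∣ (1≤card {K} (_ , IsSubgroup.0∈ (stab-subgroup s∈S)))))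
            (∈-stab⁺ s∈S stable)))
          (identity! (:- :0) :0 [])))

      term-pred : ∀ s₀ i {x} → x + (- d) ≈ s₀ + i ×ᴳ d → x ≈ s₀ + suc i ×ᴳ d
      term-pred s₀ i {x} eq = ≈-trans (identity! v0 (v0 :+ :- v1 :+ v1) (x ∷ d ∷ []))
        (≈-trans (+-congʳ eq) (identity! (v0 :+ v1 :+ v2) (v0 :+ (v2 :+ v1)) (s₀ ∷ i ×ᴳ d ∷ d ∷ [])))

      -- Otherwise the points of S from which all steps by d stay in S would
      -- form a set stable under d, hence under - d.
      exit : ∀ {s₀} → s₀ ∈ S → s₀ + (- d) ∉ S → ∃[ i ] s₀ + i ×ᴳ d ∉ S
      exit {s₀} s₀∈S s₀-d∉S = by-contradiction λ none →
        let C = select (λ x → ∀ i → x + i ×ᴳ d ∈ S) S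
            C-resp : (λ x → ∀ i → x + i ×ᴳ d ∈ S) Respects _≈_
            C-resp = λ x≈ x∈ i → ∈-resp (+-congʳ x≈) (x∈ i)
            stable : Stabilises d C
            stable = λ x x∈C → let x∈S , ray = ∈-select⁻ {X = S} C-resp x∈C in
              ∈-select⁺ C-resp
                (∈-resp (identity! (v0 :+ (v1 :+ :0)) (v1 :+ v0) (x ∷ d ∷ [])) (ray 1))
                (λ i → ∈-resp (identity! (v0 :+ (v1 :+ v2)) (v1 :+ v0 :+ v2) (x ∷ d ∷ i ×ᴳ d ∷ []))
                  (ray (suc i)))
            s₀∈C = ∈-select⁺ C-resp s₀∈S (λ i → by-contradiction λ ∉S → none (i , ∉S))
        in s₀-d∉S (∈-resp (+-comm (- d) s₀)
             (proj₁ (∈-select⁻ {X = S} C-resp (stabilises-neg stable s₀ s₀∈C))))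

      module _ {s₀} (s₀∈S : s₀ ∈ S) (s₀-d∉S : s₀ + (- d) ∉ S) {m : ℕ}
               (exits : s₀ + m ×ᴳ d ∉ S) (inside : ∀ {i} → i < m → s₀ + i ×ᴳ d ∈ S) where

        1≤m : 1 ≤ m
        1≤m = ℕ.n≢0⇒n>0 λ m≡0 → exits (≡.subst (λ i → s₀ + i ×ᴳ d ∈ S) (≡.sym m≡0)
          (∈-resp (≈-sym (+-identityʳ s₀)) s₀∈S))

        -- `P` is the run of S from its starting point to the first exit; `R` will turn out to be a
        -- union of cosets of the group generated by `d`.
        P R : FinSet
        P = progression s₀ d m
        R = S ∖ P

        s₀∈P : s₀ ∈ P
        s₀∈P = ∈-resp (+-identityʳ s₀) (∈-progression⁺ s₀ d 1≤m)

        P⊆S : P ⊆ S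
        P⊆S p = let i , i<m , eq = ∈-progression⁻ s₀ d p in ∈-resp (≈-sym eq) (inside i<m)

        -- A point of R is not the start, so its predecessor lies in S. If the predecessor were in
        -- P, the point would be a term of P or the first exit, which is not in S.
        -d-stabilises-R : Stabilises (- d) R
        -d-stabilises-R y y∈R =
          let y∈S , y∉P = ∈-∖⁻ y∈R
              y-d∈S = by-contradiction λ y-d∉S →
                y∉P (∈-resp (start-unique s₀∈S y∈S s₀-d∉S y-d∉S) s₀∈P)
              y-d∉P = λ y-d∈P →
                let i , i<m , eq = ∈-progression⁻ s₀ d y-d∈P
                    y≈ = term-pred s₀ i eq
                in suc-case y∈S y∉P i<m y≈
          in ∈-resp (+-comm y (- d)) (∈-∖⁺ y-d∈S y-d∉P)
          where
          suc-case : ∀ {y i} → y ∈ S → y ∉ P → i < m → y ≈ s₀ + suc i ×ᴳ d → ⊥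
          suc-case {y} {i} y∈S y∉P i<m y≈ with ℕ.m≤n⇒m<n∨m≡n i<m
          ... | inj₁ si<m = y∉P (∈-resp (≈-sym y≈) (∈-progression⁺ s₀ d si<m))
          ... | inj₂ si≡m = exits (≡.subst (λ i → s₀ + i ×ᴳ d ∈ S) si≡m (∈-resp y≈ y∈S))

        -- The stabiliser K of R contains `d`, so P lies in a single coset of K and |K + S| ≤ |R| +
        -- |K| < |S| + |K|. By `aperiodic` K + S = G, whence |G| ≤ 2|R| < 2|S|; but T + S misses two
        -- points, so |G| ≥ |T| + |S| + 1 > 2|S|.
        R-empty : ∀ {r} → r ∉ R
        R-empty {r} r∈R = by-whole (dec (IsWhole (K ⊕ S)))
          where
          open ℕ.≤-Reasoning
          K = stab R
          K-subgroup : IsSubgroup K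
          K-subgroup = stab-subgroup r∈R
          d∈K : d ∈ K
          d∈K = ∈-resp (-‿involutive d) (IsSubgroup.-∈ K-subgroup (∈-stab⁺ r∈R -d-stabilises-R))
          ×d∈K : ∀ i → i ×ᴳ d ∈ K
          ×d∈K zero    = IsSubgroup.0∈ K-subgroup
          ×d∈K (suc i) = IsSubgroup.+∈ K-subgroup d∈K (×d∈K i)
          K⊕S⊆ : K ⊕ S ⊆ R ++ shift s₀ K
          K⊕S⊆ p with ∈-⊕⁻ K S p
          ... | k , x , k∈ , x∈ , eq with x ∈? P
          ... | no x∉P = ∈-resp (≈-sym eq) (∈-++⁺ˡ (∈-stab⁻ k∈ x (∈-∖⁺ x∈ x∉P)))
          ... | yes x∈P with ∈-progression⁻ s₀ d x∈P
          ... | i , _ , x≈ = ∈-++⁺ʳ R (∈-resp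
            (≈-sym (≈-trans eq (≈-trans (+-congˡ x≈)
            (identity! (v0 :+ (v1 :+ v2)) (v1 :+ (v0 :+ v2)) (k ∷ s₀ ∷ i ×ᴳ d ∷ [])))))
            (∈-shift⁺ (IsSubgroup.+∈ K-subgroup k∈ (×d∈K i))))
          card-K⊕S : ∣ K ⊕ S ∣ ≤ ∣ R ∣ ℕ.+ ∣ K ∣
          card-K⊕S = begin
            ∣ K ⊕ S ∣                  ≤⟨ card-mono (K ⊕ S) (R ++ shift s₀ K) K⊕S⊆ ⟩
            ∣ R ++ shift s₀ K ∣        ≤⟨ card-∪-≤ R (shift s₀ K) ⟩
            ∣ R ∣ ℕ.+ ∣ shift s₀ K ∣   ≡⟨ ≡.cong (∣ R ∣ ℕ.+_) (card-shift s₀ K) ⟩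
            ∣ R ∣ ℕ.+ ∣ K ∣            ∎
          R<S : suc ∣ R ∣ ≤ ∣ S ∣
          R<S = ℕ.≰⇒> λ S≤R → proj₂ (∈-∖⁻ {S} (⊆∧≥⇒⊇ {R} {S} (proj₁ ∘ ∈-∖⁻) S≤R s₀∈S)) s₀∈P
          by-whole : Dec (IsWhole (K ⊕ S)) → ⊥
          by-whole (yes w) = progression-arith (∣ S ∣) (∣ T ∣) (∣ T ⊕ S ∣) (∣ K ⊕ S ∣) (∣ R ∣) (∣ K ∣)
            (+2-≤-whole {K ⊕ S} {T ⊕ S} w (room fragT)) card-K⊕S (card-stab-≤ r∈R) (tight fragT) S≤T R<S
          by-whole (no ¬w) = d≉0 (aperiodic K K-subgroup ¬w
            (begin-strict
              ∣ K ⊕ S ∣       ≤⟨ card-K⊕S ⟩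
              ∣ R ∣ ℕ.+ ∣ K ∣ ≡⟨ ℕ.+-comm ∣ R ∣ ∣ K ∣ ⟩
              ∣ K ∣ ℕ.+ ∣ R ∣ <⟨ ℕ.+-monoʳ-< ∣ K ∣ R<S ⟩
              ∣ K ∣ ℕ.+ ∣ S ∣ ∎) d∈K)

        chain⇒progression : IsArithmeticProgression S
        chain⇒progression = s₀ , d , m , 1≤m ,
          (λ x∈S → by-contradiction λ x∉P → R-empty (∈-∖⁺ x∈S x∉P)) , P⊆S

      almost-periodic⇒progression : IsArithmeticProgression S
      almost-periodic⇒progression =
        let s₀ , s₀∈S , s₀-d∉S = start
            i , exits = exit s₀∈S s₀-d∉S
            m , first , least = minimum em (λ i → s₀ + i ×ᴳ d ∉ S) i exits
        in chain⇒progression s₀∈S s₀-d∉S first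
             λ {i} i<m → by-contradiction λ ∉S → ℕ.<⇒≱ i<m (least i ∉S)

  -- Periodicity of the difference sets when the hyper-atom is non-zero.

  module PeriodicCase
    (S : FinSet) (generates : Generates (S ⊖ S))
    (H : FinSet) (H-subgroup : IsSubgroup H) (H⊕S≠G : ¬ IsWhole (H ⊕ S))
    (thin : ∣ H ⊕ S ∣ < ∣ H ∣ ℕ.+ ∣ S ∣) where

    open IsSubgroup H-subgroup

    slice : Carrier → FinSet
    slice x = S ∩ shift x H

    -- Passing from S to H + S fills both cosets and adds fewer than |H| points, so fewer than |H|
    -- of the 2|H| points of the two cosets are missing from S.
    slices-large : ∀ {x y} → x ∈ S → y ∈ S → x + (- y) ∉ H → ∣ H ∣ < ∣ slice x ∣ ℕ.+ ∣ slice y ∣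
    slices-large {x} {y} x∈S y∈S x-y∉H =
      coset-arith (∣ H ∣) (∣ U ∣) (∣ S ∖ U ∣) (∣ H ⊕ S ∣) (∣ S ∣) (∣ S ∩ U ∣) (∣ slice x ∣) (∣ slice y ∣)
        card-U
        (≡.subst (_≤ ∣ H ⊕ S ∣) (card-∪-∖ U S) (card-mono (U ++ S) (H ⊕ S) (λ p → in-H⊕S (∈-++⁻ U p))))
        thin
        (card-split S U)
        (ℕ.≤-trans (card-mono (S ∩ U) (slice x ++ slice y) split) (card-∪-≤ (slice x) (slice y)))
      where
      U = shift x H ++ shift y H

      card-U : ∣ U ∣ ≡ ∣ H ∣ ℕ.+ ∣ H ∣
      card-U = ≡.trans (card-⊎ {shift x H} {shift y H} λ {z} z∈x z∈y → x-y∉H (∈-resp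
        (identity! (v0 :+ :- v1 :+ :- (v0 :+ :- v2)) (v2 :+ :- v1) (z ∷ y ∷ x ∷ []))
        (+∈ (∈-shift⁻′ z∈y) (-∈ (∈-shift⁻′ z∈x)))))
        (≡.cong₂ ℕ._+_ (card-shift x H) (card-shift y H))

      in-U : ∀ {z} → z ∈ shift x H ⊎ z ∈ shift y H → z ∈ H ⊕ S
      in-U (inj₁ p) = shift-⊆-⊕ H x∈S p
      in-U (inj₂ p) = shift-⊆-⊕ H y∈S p

      in-H⊕S : ∀ {z} → z ∈ U ⊎ z ∈ S → z ∈ H ⊕ S
      in-H⊕S (inj₁ p) = in-U (∈-++⁻ (shift x H) p)
      in-H⊕S {z} (inj₂ z∈S) = ∈-resp (+-identityˡ z) (∈-⊕⁺ 0∈ z∈S)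

      split : S ∩ U ⊆ slice x ++ slice y
      split p = let z∈S , z∈U = ∈-∩⁻ {S} p in go z∈S (∈-++⁻ (shift x H) z∈U)
        where
        go : ∀ {z} → z ∈ S → z ∈ shift x H ⊎ z ∈ shift y H → z ∈ slice x ++ slice y
        go z∈S (inj₁ q) = ∈-++⁺ˡ (∈-∩⁺ z∈S q)
        go z∈S (inj₂ q) = ∈-++⁺ʳ (slice x) (∈-∩⁺ z∈S q)

    -- With d = x - y + h, the slice of `x` and the translate by `d` of the slice of `y` lie in the
    -- same coset x + H. They are too large to be disjoint, and a common point z = d + w gives d = z
    -- - w.
    difference∈ : ∀ {x y h} → ∣ H ∣ < ∣ slice x ∣ ℕ.+ ∣ slice y ∣ → h ∈ H → x + (- y) + h ∈ S ⊖ S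
    difference∈ {x} {y} {h} large h∈H =
      let d = x + (- y) + h
          z , z∈x , z∈d+y = card-overlap {slice x} {shift d (slice y)} {shift x H}
            (proj₂ ∘ ∈-∩⁻ {S})
            (λ {z} p → ∈-shift⁺′ (∈-resp
              (identity! (v0 :+ :- (v1 :+ :- v2 :+ v3) :+ :- v2 :+ v3) (v0 :+ :- v1) (z ∷ x ∷ y ∷ h ∷ []))
              (+∈ (∈-shift⁻′ (proj₂ (∈-∩⁻ {S} (∈-shift⁻′ p)))) h∈H)))
            (≡.subst₂ (λ m n → m < ∣ slice x ∣ ℕ.+ n) (≡.sym (card-shift x H))
              (≡.sym (card-shift d (slice y))) large)
          w , w∈y , z≈d+w = ∈-shift⁻ z∈d+y
      in ∈-resp (≈-trans (+-congʳ z≈d+w) (identity! (v0 :+ v1 :+ :- v1) v0 (d ∷ w ∷ [])))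
           (∈-⊖⁺ (proj₁ (∈-∩⁻ z∈x)) (proj₁ (∈-∩⁻ w∈y)))

    -- If S lay in one coset of H, then S - S would generate a subgroup of H, so H and hence H + S
    -- would be all of G.
    other-coset : ∀ {x} → x ∈ S → ∃[ y ] (y ∈ S × x + (- y) ∉ H)
    other-coset {x} x∈S = by-contradiction λ none →
      let S⊆x-H = λ {y} y∈S → by-contradiction λ x-y∉H → none (y , y∈S , x-y∉H)
      in H⊕S≠G λ g → ∈-resp (identity! (v0 :+ :- v1 :+ v1) v0 (g ∷ x ∷ []))
           (∈-⊕⁺ (span⊆H S⊆x-H (generates (g + (- x)))) x∈S)
      where
      span⊆H : (∀ {y} → y ∈ S → x + (- y) ∈ H) → ∀ {g} → ⟨ S ⊖ S ⟩ g → g ∈ H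
      span⊆H near (gen p) = let y , z , y∈ , z∈ , eq = ∈-⊖⁻ S S p in
        ∈-resp (≈-trans (identity! (v0 :+ :- v1 :+ :- (v0 :+ :- v2)) (v2 :+ :- v1) (x ∷ z ∷ y ∷ []))
            (≈-sym eq))
          (+∈ (near z∈) (-∈ (near y∈)))
      span⊆H near zer        = 0∈
      span⊆H near (add p q)  = +∈ (span⊆H near p) (span⊆H near q)
      span⊆H near (neg p)    = -∈ (span⊆H near p)
      span⊆H near (resp e p) = ∈-resp e (span⊆H near p)

    -- One of two distinct slices has more than |H| / 2 elements, and by the pigeonhole
    -- principle every element of H is a difference of two elements of that slice.
    H⊆S⊖S : ∀ {x} → x ∈ S → H ⊆ S ⊖ S
    H⊆S⊖S {x} x∈S {h} h∈H =
      let y , y∈S , x-y∉H = other-coset x∈S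
      in from-half (half-< (∣ slice x ∣) (∣ slice y ∣) (slices-large x∈S y∈S x-y∉H))
      where
      from-slice : ∀ {z} → ∣ H ∣ < ∣ slice z ∣ ℕ.+ ∣ slice z ∣ → h ∈ S ⊖ S
      from-slice {z} large =
        ∈-resp (identity! (v0 :+ :- v0 :+ v1) v1 (z ∷ h ∷ [])) (difference∈ {z} {z} large h∈H)
      from-half : ∀ {y} → ∣ H ∣ < ∣ slice x ∣ ℕ.+ ∣ slice x ∣ ⊎ ∣ H ∣ < ∣ slice y ∣ ℕ.+ ∣ slice y ∣ →
                  h ∈ S ⊖ S
      from-half (inj₁ large) = from-slice large
      from-half (inj₂ large) = from-slice large

    -- If x and y share a coset, the element is in H and `H⊆S⊖S` applies; otherwise the pigeonhole
    -- principle applies to their slices.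
    S⊖S-periodic : ∀ {x y h} → x ∈ S → y ∈ S → h ∈ H → x + (- y) + h ∈ S ⊖ S
    S⊖S-periodic {x} {y} {h} x∈S y∈S h∈H = by-coset (dec (x + (- y) ∈ H))
      where
      by-coset : Dec (x + (- y) ∈ H) → x + (- y) + h ∈ S ⊖ S
      by-coset (yes x-y∈H) = H⊆S⊖S x∈S (+∈ x-y∈H h∈H)
      by-coset (no  x-y∉H) = difference∈ (slices-large x∈S y∈S x-y∉H) h∈H

    -- One summand is split off from each of the two sums, and the shift by H is absorbed by the
    -- difference of these two summands.
    differences-periodic : ∀ s r → (suc s · S ⊖ suc r · S) ⊕ H ≋ suc s · S ⊖ suc r · S
    differences-periodic s r = to , from
      where
      D = suc s · S ⊖ suc r · S
      to : D ⊕ H ⊆ D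
      to p =
        let d , h , d∈ , h∈ , g≈ = ∈-⊕⁻ D H p
            u , v , u∈ , v∈ , d≈ = ∈-⊖⁻ (suc s · S) (suc r · S) d∈
            x , σ , x∈ , σ∈ , u≈ = ∈-⊕⁻ S (s · S) u∈
            y , ρ , y∈ , ρ∈ , v≈ = ∈-⊕⁻ S (r · S) v∈
            x′ , y′ , x′∈ , y′∈ , eq = ∈-⊖⁻ S S (S⊖S-periodic x∈ y∈ h∈)
        in ∈-resp (≈-sym (≈-trans g≈ (≈-trans (+-congʳ (≈-trans d≈ (+-cong u≈ (-‿cong v≈))))
             (≈-trans (identity! (v0 :+ v1 :+ :- (v2 :+ v3) :+ v4) (v0 :+ :- v2 :+ v4 :+ (v1 :+ :- v3))
                 (x ∷ σ ∷ y ∷ ρ ∷ h ∷ []))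
               (≈-trans (+-congʳ eq)
                 (identity! (v0 :+ :- v2 :+ (v1 :+ :- v3)) (v0 :+ v1 :+ :- (v2 :+ v3))
                   (x′ ∷ σ ∷ y′ ∷ ρ ∷ [])))))))
             (∈-⊖⁺ (∈-⊕⁺ x′∈ σ∈) (∈-⊕⁺ y′∈ ρ∈))
      from : D ⊆ D ⊕ H
      from {x} p = ∈-resp (+-identityʳ x) (∈-⊕⁺ p 0∈)

  -- Growth of iterated sums and differences.

  module Growth
    (S : FinSet) {s₀ : Carrier} (s₀∈S : s₀ ∈ S)
    (vosper : ∀ X → ∣ S ∣ ≤ ∣ X ∣ → TwoOutside (X ⊕ S) → ∣ X ∣ ℕ.+ ∣ S ∣ ≤ ∣ X ⊕ S ∣)
    where

    -- The invariant of the induction: the first half makes `vosper` applicable to the next sum, and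
    -- the second is the lower bound, claimed only while two points are missed.
    Grown : ℕ → FinSet → Set (c ⊔ ℓ)
    Grown k X = ∣ S ∣ ≤ ∣ X ∣ × (TwoOutside X → k ≤ ∣ X ∣)

    grown-≋ : ∀ {k} X Y → X ≋ Y → Grown k X → Grown k Y
    grown-≋ {k} X Y X≋Y (S≤X , k≤X) =
      ≡.subst (∣ S ∣ ≤_) (card-cong X Y X≋Y) S≤X ,
      λ room → ≡.subst (k ≤_) (card-cong X Y X≋Y) (k≤X (TwoOutside-⊆ X Y (proj₁ X≋Y) room))

    grown-⊕ : ∀ {k} X → Grown k X → Grown (∣ S ∣ ℕ.+ k) (X ⊕ S)
    grown-⊕ {k} X (S≤X , k≤X) = ℕ.≤-trans S≤X (card-≤-⊕ˡ X s₀∈S) , λ room → begin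
      ∣ S ∣ ℕ.+ k      ≡⟨ ℕ.+-comm ∣ S ∣ k ⟩
      k ℕ.+ ∣ S ∣      ≤⟨ ℕ.+-monoˡ-≤ ∣ S ∣ (k≤X (unshift room)) ⟩
      ∣ X ∣ ℕ.+ ∣ S ∣  ≤⟨ vosper X S≤X room ⟩
      ∣ X ⊕ S ∣        ∎
      where
      open ℕ.≤-Reasoning
      -- X + s₀ is contained in X + S, so points outside the sum, moved by - s₀, lie outside X.
      unshift : TwoOutside (X ⊕ S) → TwoOutside X
      unshift (g , h , g≉h , g∉ , h∉) =
        g + (- s₀) , h + (- s₀) , g≉h ∘ +-cancelʳ (- s₀) g h , out g∉ , out h∉
        where
        out : ∀ {g} → g ∉ X ⊕ S → g + (- s₀) ∉ X
        out {g} g∉ p = g∉ (∈-resp (identity! (v0 :+ :- v1 :+ v1) v0 (g ∷ s₀ ∷ [])) (∈-⊕⁺ p s₀∈S))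

    grown-opp : ∀ {k} X → Grown k X → Grown k (opp X)
    grown-opp {k} X (S≤X , k≤X) =
      ≡.subst (∣ S ∣ ≤_) (≡.sym (card-opp X)) S≤X ,
      λ (g , h , g≉h , g∉ , h∉) → ≡.subst (k ≤_) (≡.sym (card-opp X))
        (k≤X (- g , - h , g≉h ∘ -‿injective , out g∉ , out h∉))
      where
      out : ∀ {g} → g ∉ opp X → - g ∉ X
      out {g} g∉ p = g∉ (∈-resp (-‿involutive g) (∈-opp⁺ p))

    -- X - S is the negative of (- X) + S, which reduces differences to sums.
    grown-⊖ : ∀ {k} X → Grown k X → Grown (∣ S ∣ ℕ.+ k) (X ⊖ S)
    grown-⊖ X grown = grown-≋ (opp (opp X ⊕ S)) (X ⊖ S) (to , from)
      (grown-opp (opp X ⊕ S) (grown-⊕ (opp X) (grown-opp X grown)))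
      where
      to : opp (opp X ⊕ S) ⊆ X ⊖ S
      to p =
        let y , y∈ , z≈ = ∈-opp⁻ p
            x , s , x∈ , s∈ , y≈ = ∈-⊕⁻ (opp X) S y∈
        in ∈-resp (≈-trans (identity! (:- v0 :+ :- v1) (:- (v0 :+ v1)) (x ∷ s ∷ []))
             (≈-trans (-‿cong (≈-sym y≈)) (≈-sym z≈))) (∈-⊖⁺ (∈-opp⁻′ x∈) s∈)
      from : X ⊖ S ⊆ opp (opp X ⊕ S)
      from p =
        let x , s , x∈ , s∈ , z≈ = ∈-⊖⁻ X S p
        in ∈-resp (≈-trans (identity! (:- (:- v0 :+ v1)) (v0 :+ :- v1) (x ∷ s ∷ [])) (≈-sym z≈))
             (∈-opp⁺ (∈-⊕⁺ (∈-opp⁺ x∈) s∈))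

    -- The subtracted `0 · S` is {0}; it gives the base case of `grown-difference` its exact form.
    grown-sum : ∀ s → Grown (suc s * ∣ S ∣) (suc s · S ⊖ 0 · S)
    grown-sum zero = grown-≋ S (1 · S ⊖ 0 · S) (to , from)
      (ℕ.≤-refl , λ _ → ℕ.≤-reflexive (ℕ.+-identityʳ ∣ S ∣))
      where
      to : S ⊆ 1 · S ⊖ 0 · S
      to {x} x∈ = ∈-resp (identity! (v0 :+ :0 :+ :- :0) v0 (x ∷ []))
        (∈-⊖⁺ {1 · S} {0 · S} (∈-⊕⁺ x∈ (here ≈-refl)) (here ≈-refl))
      from : 1 · S ⊖ 0 · S ⊆ S
      from p with ∈-⊖⁻ (1 · S) (0 · S) p
      ... | u , v , u∈ , here v≈ , z≈ with ∈-⊕⁻ S (0 · S) u∈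
      ... | x , w , x∈ , here w≈ , u≈ = ∈-resp (≈-sym (≈-trans z≈ (≈-trans
        (+-cong (≈-trans u≈ (+-congˡ w≈)) (-‿cong v≈)) (identity! (v0 :+ :0 :+ :- :0) v0 (x ∷ []))))) x∈
    grown-sum (suc s) = grown-≋ ((suc s · S ⊖ 0 · S) ⊕ S) (suc (suc s) · S ⊖ 0 · S) (to , from)
      (grown-⊕ (suc s · S ⊖ 0 · S) (grown-sum s))
      where
      to : (suc s · S ⊖ 0 · S) ⊕ S ⊆ suc (suc s) · S ⊖ 0 · S
      to p =
        let d , x , d∈ , x∈ , z≈ = ∈-⊕⁻ (suc s · S ⊖ 0 · S) S p
            u , v , u∈ , v∈ , d≈ = ∈-⊖⁻ (suc s · S) (0 · S) d∈
        in ∈-resp (≈-sym (≈-trans z≈ (≈-trans (+-congʳ d≈)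
             (identity! (v0 :+ :- v1 :+ v2) (v2 :+ v0 :+ :- v1) (u ∷ v ∷ x ∷ [])))))
             (∈-⊖⁺ {suc (suc s) · S} {0 · S} (∈-⊕⁺ x∈ u∈) v∈)
      from : suc (suc s) · S ⊖ 0 · S ⊆ (suc s · S ⊖ 0 · S) ⊕ S
      from p =
        let u , v , u∈ , v∈ , z≈ = ∈-⊖⁻ (suc (suc s) · S) (0 · S) p
            x , w , x∈ , w∈ , u≈ = ∈-⊕⁻ S (suc s · S) u∈
        in ∈-resp (≈-sym (≈-trans z≈ (≈-trans (+-congʳ u≈)
             (identity! (v0 :+ v1 :+ :- v2) (v1 :+ :- v2 :+ v0) (x ∷ w ∷ v ∷ [])))))
             (∈-⊕⁺ (∈-⊖⁺ {suc s · S} {0 · S} w∈ v∈) x∈)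

    -- The factor is written with `r` first, so that raising `r` by one adds |S| on the left by
    -- computation, as in `grown-⊖`.
    grown-difference : ∀ s r → Grown ((r ℕ.+ suc s) * ∣ S ∣) (suc s · S ⊖ r · S)
    grown-difference s zero = grown-sum s
    grown-difference s (suc r) = grown-≋ ((A ⊖ r · S) ⊖ S) (A ⊖ suc r · S) (to , from)
      (grown-⊖ (A ⊖ r · S) (grown-difference s r))
      where
      A = suc s · S
      to : (A ⊖ r · S) ⊖ S ⊆ A ⊖ suc r · S
      to p =
        let d , x , d∈ , x∈ , z≈ = ∈-⊖⁻ (A ⊖ r · S) S p
            u , v , u∈ , v∈ , d≈ = ∈-⊖⁻ A (r · S) d∈
        in ∈-resp (≈-sym (≈-trans z≈ (≈-trans (+-congʳ d≈)
             (identity! (v0 :+ :- v1 :+ :- v2) (v0 :+ :- (v2 :+ v1)) (u ∷ v ∷ x ∷ [])))))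
             (∈-⊖⁺ {A} {suc r · S} u∈ (∈-⊕⁺ x∈ v∈))
      from : A ⊖ suc r · S ⊆ (A ⊖ r · S) ⊖ S
      from p =
        let u , v , u∈ , v∈ , z≈ = ∈-⊖⁻ A (suc r · S) p
            x , w , x∈ , w∈ , v≈ = ∈-⊕⁻ S (r · S) v∈
        in ∈-resp (≈-sym (≈-trans z≈ (≈-trans (+-congˡ (-‿cong v≈))
             (identity! (v0 :+ :- (v1 :+ v2)) (v0 :+ :- v2 :+ :- v1) (u ∷ x ∷ w ∷ [])))))
             (∈-⊖⁺ (∈-⊖⁺ u∈ w∈) x∈)

  -- Consequences of the hyper-atom property.

  module HyperAtoms
    (S : FinSet) {s₀ : Carrier} (s₀∈S : s₀ ∈ S) (S≠G : ¬ IsWhole S)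
    (H : FinSet) (hyper-atom : IsHyperAtom S H) where

    open IsHyperAtom hyper-atom
    open IsSubgroup

    zero⊕S : (0# ∷ []) ⊕ S ≋ S
    zero⊕S = to , λ {x} x∈ → ∈-resp (+-identityˡ x) (∈-⊕⁺ {0# ∷ []} (here ≈-refl) x∈)
      where
      to : (0# ∷ []) ⊕ S ⊆ S
      to p with ∈-⊕⁻ (0# ∷ []) S p
      ... | x , s , here x≈0 , s∈ , z≈ =
        ∈-resp (≈-sym (≈-trans z≈ (≈-trans (+-congʳ x≈0) (+-identityˡ s)))) s∈

    card-zero⊕S : ∣ (0# ∷ []) ⊕ S ∣ ≡ ∣ S ∣
    card-zero⊕S = card-cong ((0# ∷ []) ⊕ S) S zero⊕S

    zero-admissible : Admissible S (0# ∷ [])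
    zero-admissible = (0# , here ≈-refl) , λ whole → S≠G λ g → proj₁ zero⊕S (whole g)

    excess-H-least : ∀ X → Admissible S X → excess S H ≤ excess S X
    excess-H-least X adm = proj₂ (proj₂ fragment) (excess S X) (X , adm , ≡.refl)

    excess-H≤ : excess S H ≤ pred ∣ S ∣
    -- The test set is {0}, admissible because S ≠ G, with excess |S| - 1.
    excess-H≤ = ≡.subst (λ n → excess S H ≤ pred n) card-zero⊕S (excess-H-least (0# ∷ []) zero-admissible)

    suc-pred-S : suc (pred ∣ S ∣) ≡ ∣ S ∣
    suc-pred-S = ℕ.suc-pred ∣ S ∣ {{ℕ.>-nonZero (1≤card {S} (_ , s₀∈S))}}

    +-pred-S : ∀ m → suc (m ℕ.+ pred ∣ S ∣) ≡ m ℕ.+ ∣ S ∣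
    +-pred-S m = ≡.trans (≡.sym (ℕ.+-suc m (pred ∣ S ∣))) (≡.cong (m ℕ.+_) suc-pred-S)

    thin-H : ∣ H ⊕ S ∣ < ∣ H ∣ ℕ.+ ∣ S ∣
    thin-H = ≡.subst (suc ∣ H ⊕ S ∣ ≤_) (+-pred-S ∣ H ∣)
      (s≤s (ℕ.≤-trans (ℕ.m≤n+m∸n (∣ H ⊕ S ∣) (∣ H ∣)) (ℕ.+-monoʳ-≤ ∣ H ∣ excess-H≤)))

    module _ (H≋0 : H ≋ 0# ∷ []) where

      card-H : ∣ H ∣ ≡ 1
      card-H = card-cong H (0# ∷ []) H≋0

      excess-H : excess S H ≡ pred ∣ S ∣
      excess-H = ≡.trans (≡.cong₂ ℕ._∸_ card-H⊕S card-H) ≡.refl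
        where
        card-H⊕S : ∣ H ⊕ S ∣ ≡ ∣ S ∣
        card-H⊕S = ≡.trans (card-cong (H ⊕ S) ((0# ∷ []) ⊕ S)
          (⊕-monoˡ H (0# ∷ []) S (proj₁ H≋0) , ⊕-monoˡ (0# ∷ []) H S (proj₂ H≋0))) card-zero⊕S

      -- The fragment H = {0} has excess |S| - 1, which is therefore the minimum κ₁(S).
      bound : ∀ X → NonEmpty X → ¬ IsWhole (X ⊕ S) → ∣ X ∣ ℕ.+ ∣ S ∣ ≤ suc ∣ X ⊕ S ∣
      bound X non-empty non-whole = begin
        ∣ X ∣ ℕ.+ ∣ S ∣               ≡⟨ +-pred-S ∣ X ∣ ⟨
        suc (∣ X ∣ ℕ.+ pred ∣ S ∣)    ≡⟨ ≡.cong (λ n → suc (∣ X ∣ ℕ.+ n)) excess-H ⟨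
        suc (∣ X ∣ ℕ.+ excess S H)    ≤⟨ s≤s (ℕ.+-monoʳ-≤ ∣ X ∣ (excess-H-least X (non-empty , non-whole))) ⟩
        suc (∣ X ∣ ℕ.+ excess S X)    ≡⟨ ≡.cong suc (ℕ.m+[n∸m]≡n (card-≤-⊕ˡ X s₀∈S)) ⟩
        suc ∣ X ⊕ S ∣                 ∎
        where open ℕ.≤-Reasoning

      -- Such a `K` has excess at most κ₁(S), so it is a fragment containing H = {0}, and maximality
      -- puts it inside H.
      aperiodic : ∀ K → IsSubgroup K → ¬ IsWhole (K ⊕ S) → ∣ K ⊕ S ∣ < ∣ K ∣ ℕ.+ ∣ S ∣ →
                  ∀ {k} → k ∈ K → k ≈ 0#
      aperiodic K K-subgroup non-whole thin k∈K =
        zero-only (proj₁ H≋0 (maximal K K-subgroup K-fragment H⊆K k∈K))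
        where
        zero-only : ∀ {k} → k ∈ 0# ∷ [] → k ≈ 0#
        zero-only (here k≈0) = k≈0
        H⊆K : H ⊆ K
        H⊆K h∈H = ∈-resp (≈-sym (zero-only (proj₁ H≋0 h∈H))) (0∈ K-subgroup)
        K-admissible : Admissible S K
        K-admissible = (0# , 0∈ K-subgroup) , non-whole
        excess-K≤ : excess S K ≤ excess S H
        excess-K≤ = ≡.subst (excess S K ≤_) (≡.sym excess-H)
          (ℕ.m≤n+o⇒m∸n≤o (∣ K ⊕ S ∣) (∣ K ∣)
            (ℕ.s≤s⁻¹ (≡.subst (suc ∣ K ⊕ S ∣ ≤_) (≡.sym (+-pred-S ∣ K ∣)) thin)))
        K-fragment : IsFragment S K
        K-fragment = K-admissible , (K , K-admissible , ≡.refl) ,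
          λ n Pn → ℕ.≤-trans excess-K≤ (proj₂ (proj₂ fragment) n Pn)

-- The cases of a zero and a non-zero hyper-atom combined.

theorem15 : ∀ {c ℓ} (em : ExcludedMiddle (c ⊔ ℓ)) (G : AbelianGroup c ℓ) →
    let open Additive em G in
    ∀ (r s : ℕ) → r ≥ s → s ≥ 1 →
    ∀ (S : FinSet) → NonEmpty S → ¬ IsWhole S → Generates (S ⊖ S) →
    ∀ (H : FinSet) → IsHyperAtom S H →
    IsArithmeticProgression S
    ⊎ ∣ s · S ⊖ r · S ∣ ≥ min (pred⁺ ∣G∣) ((r +ℕ s) * ∣ S ∣)
    ⊎ (¬ (H ≋ 0# ∷ []) × (s · S ⊖ r · S) ⊕ H ≋ s · S ⊖ r · S)
theorem15 em G (suc r) (suc s) _ _ S (s₀ , s₀∈S) S≠G generates H hyper-atom =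
  by-H (dec (H ≋ 0# ∷ []))
  where
  open Additive em G
  open Sumsets em G
  open HyperAtoms S s₀∈S S≠G H hyper-atom
  D = suc s · S ⊖ suc r · S

  by-H : Dec (H ≋ 0# ∷ []) →
    IsArithmeticProgression S
    ⊎ ∣ D ∣ ≥ min (pred⁺ ∣G∣) ((suc r +ℕ suc s) * ∣ S ∣)
    ⊎ (¬ (H ≋ 0# ∷ []) × D ⊕ H ≋ D)
  by-H (no H≉0) = inj₂ (inj₂ (H≉0 , differences-periodic s r))
    where open PeriodicCase S generates H (IsHyperAtom.subgroup hyper-atom)
                 (proj₂ (proj₁ (IsHyperAtom.fragment hyper-atom))) thin-H
  by-H (yes H≋0) = by-progression (dec (IsArithmeticProgression S))
    where
    open Fragments S (bound H≋0) (aperiodic H≋0)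
    by-progression : Dec (IsArithmeticProgression S) →
      IsArithmeticProgression S
      ⊎ ∣ D ∣ ≥ min (pred⁺ ∣G∣) ((suc r +ℕ suc s) * ∣ S ∣)
      ⊎ (¬ (H ≋ 0# ∷ []) × D ⊕ H ≋ D)
    by-progression (yes progression) = inj₁ progression
    by-progression (no ¬progression) = inj₂ (inj₁ (min-≤ {D} (proj₂ (grown-difference s (suc r)))))
      where
      2≤S : 2 ≤ ∣ S ∣
      2≤S = ℕ.≮⇒≥ λ S<2 → ¬progression (singleton-progression s₀∈S (ℕ.<⇒≱ S<2))
      vosper : ∀ X → ∣ S ∣ ≤ ∣ X ∣ → TwoOutside (X ⊕ S) → ∣ X ∣ ℕ.+ ∣ S ∣ ≤ ∣ X ⊕ S ∣
      vosper X S≤X room = ℕ.≮⇒≥ λ thin →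
        -- A violation of the inequality is a fragment of size at least |S|, from which S would be a
        -- progression.
        let frag = record { 2≤ = ℕ.≤-trans 2≤S S≤X ; room = room ; thin = thin }
            d , d≉0 , almost = fragment⇒almost-periodic {X} frag S≤X 2≤S
        in ¬progression (almost-periodic⇒progression S≠G {X} frag S≤X s₀∈S d≉0 almost)
      open Growth S s₀∈S vosper
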